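{- Let $\Omega$ be a finite state space, $r,r'\in\mathbb{H}_1\Omega$ two atomic programs (each regarded as a single-event structure), $b,c$ tests (also regarded as single-event structures), and $\mathcal{E},\mathcal{F}$ bundle event structures with internal probability over $\Omega$. Write $r^{*}=r*1$. Then \begin{align*} r^{*}\|r^{*}&\sqsubseteq_{\mathrm{sim}}r^{*},\\ r^{*}\|r'&\sqsubseteq_{\mathrm{sim}}r*(r'\cdot r^{*}),\\ r^{*}\|(b\cdot\mathcal{E}+c\cdot\mathcal{F})&\sqsubseteq_{\mathrm{sim}}r*\bigl(b\cdot(r^{*}\|\mathcal{E})+c\cdot(r^{*}\|\mathcal{F})\bigr),\\ r^{*}\|(r'\cdot\mathcal{E})&\sqsubseteq_{\mathrm{sim}}r*\bigl(r'\cdot(r^{*}\|\mathcal{E})\bigr). \end{align*}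
   Context: **Programs.** $\Omega$ is a fixed finite set of states. $\mathbb{D}\Omega$ is the set of distributions on $\Omega$, viewed inside $\mathbb{R}^\Omega$; $\delta_s$ is the point distribution at $s$. $\mathbb{H}_1\Omega$ is the set of maps $r:\Omega\to\mathcal{P}(\mathbb{D}\Omega)$ such that each $r(s)$ is non-empty, convex and topologically closed. A test is a map $b:\Omega\to\mathcal{P}(\mathbb{D}\Omega)$ with $b(s)\subseteq\{\delta_s\}$. $\overline{\mathbb{H}}_1\Omega$ is $\mathbb{H}_1\Omega$ together with all tests, ordered by $r\sqsubseteq_{\mathbb{H}}r'$ iff $r(s)\subseteq r'(s)$ for all $s$. $\delta$ denotes the program $\delta(s)=\{\delta_s\}$. **ipBES.** A bundle event structure with internal probability (ipBES) is $\mathcal{E}=(E,\mapsto,\#,\lambda,\mathbf{\Phi})$ where $E$ is a set of events; $\#$ is an irreflexive symmetric relation on $E$; for $x,x'\subseteq E$, $x\#x'$ means $e\#e'$ for all $e\in x,e'\in x'$ with $e\ne e'$; $\mapsto\subseteq\mathcal{P}(E)\times E$ satisfies $x\#x$ whenever $x\mapsto e$; $\lambda:E\to\overline{\mathbb{H}}_1\Omega$; $\mathbf{\Phi}\subseteq\mathcal{P}(E)$ with $x\#x$ for $x\in\mathbf{\Phi}$. $\mathbf{in}(\mathcal{E})$ is the set of initial events, i.e. events $e$ with no bundle $x\mapsto e$. **Traces.** A finite trace is a finite sequence $e_1\cdots e_n$ of distinct, pairwise non-conflicting events such that for every $j$ and every bundle $x\mapsto e_j$ there is $i<j$ with $e_i\in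 x$. $\mathcal{T}(\mathcal{E})$ is the set of finite traces (empty trace $\emptyset$), $\mathcal{T}_{\max}(\mathcal{E})$ the set of prefix-maximal ones. A trace $\alpha$ is weakly maximal if it is maximal or there are events $e_1,\dots,e_n$ with $\alpha e_1\cdots e_n\in\mathcal{T}_{\max}(\mathcal{E})$ and $\delta\sqsubseteq_{\mathbb{H}}\lambda(e_i)$ for all $i$. **t-simulation.** A function $f:\mathcal{T}(\mathcal{E})\to\mathcal{T}(\mathcal{F})$ is a t-simulation if: (i) $f(\emptyset)=\emptyset$ and $f^{ -1}(\beta)$ is finite for every $\beta\in\mathcal{T}(\mathcal{F})$; (ii) if $\alpha e\in\mathcal{T}(\mathcal{E})$ then either $f(\alpha e)=f(\alpha)$ and $\lambda(e)\sqsubseteq_{\mathbb{H}}\delta$, or there is an event $e'$ of $\mathcal{F}$ with $\lambda(e)\sqsubseteq_{\mathbb{H}}\lambda(e')$ and $f(\alpha e)=f(\alpha)e'$; (iii) if $\alpha e$ is maximal in $\mathcal{T}(\mathcal{E})$ then $f(\alpha e)=f(\alpha)e'$ for some $e'$ with $\lambda(e)\sqsubseteq_{\mathbb{H}}\lambda(e')$, and $f(\alpha e)$ is weakly maximal in $\mathcal{T}(\mathcal{F})$. $\mathcal{E}\sqsubseteq_{\mathrm{sim}}\mathcal{F}$ means there is a t-simulation from $\mathcal{E}$ to $\mathcal{F}$. **Operations on ipBES** (event sets of the operands are taken disjoint, using fresh copies if necessary). - An atomic action $a\in\overline{\mathbb{H}}_1\Omega$ is identified with the structure with one event $e$ labelled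 $a$, no bundles, no conflicts, and $\mathbf{\Phi}=\{\{e\}\}$; $1$ is the structure of the atomic action $\delta$. - $0$ is the structure with no events and $\mathbf{\Phi}=\emptyset$; by convention $0+\mathcal{E}=\mathcal{E}+0=\mathcal{E}$ and $0\cdot\mathcal{E}=\mathcal{E}\cdot0=\mathcal{E}$. - $\mathcal{E}+\mathcal{F}$ has events $E\cup F$, bundles $\mapsto_{\mathcal{E}}\cup\mapsto_{\mathcal{F}}$, labels $\lambda_{\mathcal{E}}\cup\lambda_{\mathcal{F}}$, exit sets $\{x\cup y: x\in\mathbf{\Phi}_{\mathcal{E}},y\in\mathbf{\Phi}_{\mathcal{F}}\}$, and conflict $\#_{\mathcal{E}}\cup\#_{\mathcal{F}}$ together with the symmetric closure of $\mathbf{in}(\mathcal{E})\times\mathbf{in}(\mathcal{F})$ and of all $x\times y$ with $x\in\mathbf{\Phi}_{\mathcal{E}}$, $y\in\mathbf{\Phi}_{\mathcal{F}}$. - $\mathcal{E}\cdot\mathcal{F}$ has events $E\cup F$, conflict $\#_{\mathcal{E}}\cup\#_{\mathcal{F}}$, bundles $\mapsto_{\mathcal{E}}\cup\mapsto_{\mathcal{F}}\cup\{x\mapsto e: x\in\mathbf{\Phi}_{\mathcal{E}},e\in\mathbf{in}(\mathcal{F})\}$, labels $\lambda_{\mathcal{E}}\cup\lambda_{\mathcal{F}}$, exit sets $\mathbf{\Phi}_{\mathcal{F}}$. - $\mathcal{E}\|\mathcal{F}=(E\cup F,\ \mapsto_{\mathcal{E}}\cup\mapsto_{\mathcal{F}},\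 \#_{\mathcal{E}}\cup\#_{\mathcal{F}},\ \lambda_{\mathcal{E}}\cup\lambda_{\mathcal{F}},\ \mathbf{\Phi}_{\mathcal{E}}\cup\mathbf{\Phi}_{\mathcal{F}})$. - $\mathcal{E}*\mathcal{F}$ (binary Kleene star) is the supremum (limit) of the increasing sequence $\mathcal{F},\ \mathcal{F}+\mathcal{E}\cdot\mathcal{F},\ \mathcal{F}+\mathcal{E}\cdot(\mathcal{F}+\mathcal{E}\cdot\mathcal{F}),\dots$. Explicitly, for $\mathcal{E}\neq0$, take disjoint copies $\mathcal{E}_k,\mathcal{F}_k$ ($k\ge0$); the events are those of all copies with their labels; the bundles are those of the copies plus $x\mapsto e$ for $x\in\mathbf{\Phi}_{\mathcal{E}_k}$, $e\in\mathbf{in}(\mathcal{F}_{k+1})\cup\mathbf{in}(\mathcal{E}_{k+1})$; the conflicts are those of the copies plus the symmetric closure of $\mathbf{in}(\mathcal{F}_k)\times\mathbf{in}(\mathcal{E}_k)$ and of $x\times y$ for $x\in\mathbf{\Phi}_{\mathcal{F}_k},y\in\mathbf{\Phi}_{\mathcal{F}_j}$, $j\ne k$; the exit sets are the unions $\bigcup_k x_k$ with $x_k\in\mathbf{\Phi}_{\mathcal{F}_k}$. -}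

module Defs where

open import Level using (0ℓ; _⊔_; Lift; lift) renaming (suc to lsuc)
open import Data.Bool.Base using (if_then_else_)
open import Data.Empty using (⊥; ⊥-elim)
open import Data.Fin.Base using (Fin; zero; suc)
import Data.Fin.Properties as Fin
open import Data.List.Base using (List; []; _∷_; _++_; _∷ʳ_)
open import Data.List.Membership.Propositional using (_∈_)
open import Data.List.Relation.Unary.All using (All)
open import Data.List.Relation.Unary.AllPairs using (AllPairs; [])
open import Data.List.Relation.Unary.Any using (Any)
open import Data.List.Relation.Unary.Unique.Propositional using (Unique)
open import Data.Nat.Base as ℕ using (ℕ; zero; suc)
import Data.Nat.Properties as ℕ
open import Data.Product.Base using (∃; ∃-syntax; _×_; _,_)
open import Data.Rational.Base as ℚ using (ℚ; 0ℚ; 1ℚ; ½)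
import Data.Rational.Properties as ℚ
open import Data.Rational.Solver using (module +-*-Solver)
open import Data.Sum.Base as Sum using (_⊎_; inj₁; inj₂; [_,_]′)
open import Data.Sum.Relation.Binary.Pointwise using (Pointwise; inj₁; inj₂)
open import Data.Unit.Base using (⊤; tt)
import Data.Vec.Functional as Vector
open import Function.Base using (_∘_)
open import Relation.Binary.Core using (Rel)
open import Relation.Binary.PropositionalEquality
  using (_≡_; _≢_; refl; sym; trans; cong; cong₂; subst)
open import Relation.Nullary.Decidable.Core using (yes; no; does)
open import Relation.Nullary.Negation.Core using (¬_)
open import Relation.Unary using (Pred; _⊆_; _≐_; ∅; ｛_｝)

-- A real is a Cauchy sequence of rationals; equality of reals is _≈ℝ_.

Eventually : (ℕ → Set) → Set
Eventually P = ∃[ N ] (∀ n → N ℕ.≤ n → P n)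

both : ∀ {P Q R : ℕ → Set} → (∀ {n} → P n → Q n → R n) →
       Eventually P → Eventually Q → Eventually R
both f (M , p) (N , q) = M ℕ.⊔ N , λ n le →
  f (p n (ℕ.≤-trans (ℕ.m≤m⊔n M N) le)) (q n (ℕ.≤-trans (ℕ.m≤n⊔m M N) le))

∣_-_∣ : ℚ → ℚ → ℚ
∣ p - q ∣ = ℚ.∣ p ℚ.- q ∣

record ℝ : Set where
  field
    seq    : ℕ → ℚ
    cauchy : ∀ ε → 0ℚ ℚ.< ε →
             ∃[ N ] (∀ m n → N ℕ.≤ m → N ℕ.≤ n → ∣ seq m - seq n ∣ ℚ.≤ ε)

open ℝ

infix 4 _≈ℝ_ _≤ℝ_

_≈ℝ_ : ℝ → ℝ → Set
x ≈ℝ y = ∀ ε → 0ℚ ℚ.< ε → Eventually (λ n → ∣ seq x n - seq y n ∣ ℚ.≤ ε)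

_≤ℝ_ : ℝ → ℝ → Set
x ≤ℝ y = ∀ ε → 0ℚ ℚ.< ε → Eventually (λ n → seq x n ℚ.≤ seq y n ℚ.+ ε)

private
  resp-≤ : ∀ {p p′ q q′} → p ≡ p′ → q ≡ q′ → p ℚ.≤ q → p′ ℚ.≤ q′
  resp-≤ refl refl p≤q = p≤q

  halve : ∀ ε → ½ ℚ.* ε ℚ.+ ½ ℚ.* ε ≡ ε
  halve ε = trans (sym (ℚ.*-distribʳ-+ ε ½ ½)) (ℚ.*-identityˡ ε)

  half>0 : ∀ {ε} → 0ℚ ℚ.< ε → 0ℚ ℚ.< ½ ℚ.* ε
  half>0 {ε} ε>0 = subst (λ p → p ℚ.< ½ ℚ.* ε) (ℚ.*-zeroʳ ½) (ℚ.*-monoʳ-<-pos ½ ε>0)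

  ≤halves : ∀ {p q r ε} → r ℚ.≤ p ℚ.+ q → p ℚ.≤ ½ ℚ.* ε → q ℚ.≤ ½ ℚ.* ε → r ℚ.≤ ε
  ≤halves {ε = ε} r≤ p≤ q≤ =
    ℚ.≤-trans r≤ (resp-≤ refl (halve ε) (ℚ.+-mono-≤ p≤ q≤))

  ∣p-p∣≤ : ∀ {p q ε} → p ≡ q → 0ℚ ℚ.< ε → ∣ p - q ∣ ℚ.≤ ε
  ∣p-p∣≤ {p} refl ε>0 =
    resp-≤ (sym (cong ℚ.∣_∣ (ℚ.+-inverseʳ p))) refl (ℚ.<⇒≤ ε>0)

  ∣-∣-comm : ∀ p q → ∣ p - q ∣ ≡ ∣ q - p ∣
  ∣-∣-comm p q = trans (sym (ℚ.∣-p∣≡∣p∣ (p ℚ.- q))) (cong ℚ.∣_∣ eq)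
    where
    open +-*-Solver
    eq : ℚ.- (p ℚ.- q) ≡ q ℚ.- p
    eq = solve 2 (λ p q → :- (p :- q) := q :- p) refl p q

  triangle : ∀ p q r → ∣ p - r ∣ ℚ.≤ ∣ p - q ∣ ℚ.+ ∣ q - r ∣
  triangle p q r = resp-≤ (cong ℚ.∣_∣ eq) refl (ℚ.∣p+q∣≤∣p∣+∣q∣ (p ℚ.- q) (q ℚ.- r))
    where
    open +-*-Solver
    eq : (p ℚ.- q) ℚ.+ (q ℚ.- r) ≡ p ℚ.- r
    eq = solve 3 (λ p q r → (p :- q) :+ (q :- r) := p :- r) refl p q r

  p≤∣p∣ : ∀ p → p ℚ.≤ ℚ.∣ p ∣
  p≤∣p∣ p with ℚ.∣p∣≡p∨∣p∣≡-p p
  ... | inj₁ eq = ℚ.≤-reflexive (sym eq)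
  ... | inj₂ eq with ℚ.≤-total 0ℚ p
  ...   | inj₁ 0≤p = ℚ.≤-reflexive (sym (ℚ.0≤p⇒∣p∣≡p 0≤p))
  ...   | inj₂ p≤0 = ℚ.≤-trans p≤0 (ℚ.0≤∣p∣ p)

  ∣+∣-≤ : ∀ p q r s → ∣ (p ℚ.+ q) - (r ℚ.+ s) ∣ ℚ.≤ ∣ p - r ∣ ℚ.+ ∣ q - s ∣
  ∣+∣-≤ p q r s = resp-≤ (cong ℚ.∣_∣ eq) refl (ℚ.∣p+q∣≤∣p∣+∣q∣ (p ℚ.- r) (q ℚ.- s))
    where
    open +-*-Solver
    eq : (p ℚ.- r) ℚ.+ (q ℚ.- s) ≡ (p ℚ.+ q) ℚ.- (r ℚ.+ s)
    eq = solve 4 (λ p q r s → (p :- r) :+ (q :- s) := (p :+ q) :- (r :+ s)) refl p q r s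

  ∣*∣-≤ : ∀ p q r s → ∣ (p ℚ.* q) - (r ℚ.* s) ∣ ℚ.≤
          ℚ.∣ p ∣ ℚ.* ∣ q - s ∣ ℚ.+ ℚ.∣ s ∣ ℚ.* ∣ p - r ∣
  ∣*∣-≤ p q r s = resp-≤ (cong ℚ.∣_∣ eq)
    (cong₂ ℚ._+_ (ℚ.∣p*q∣≡∣p∣*∣q∣ p _) (ℚ.∣p*q∣≡∣p∣*∣q∣ s _))
    (ℚ.∣p+q∣≤∣p∣+∣q∣ (p ℚ.* (q ℚ.- s)) (s ℚ.* (p ℚ.- r)))
    where
    open +-*-Solver
    eq : p ℚ.* (q ℚ.- s) ℚ.+ s ℚ.* (p ℚ.- r) ≡ p ℚ.* q ℚ.- r ℚ.* s
    eq = solve 4 (λ p q r s → p :* (q :- s) :+ s :* (p :- r) := p :* q :- r :* s) refl p q r s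

  ∣∣-∣∣≤ : ∀ p q → ℚ.∣ p ∣ ℚ.- ℚ.∣ q ∣ ℚ.≤ ∣ p - q ∣
  ∣∣-∣∣≤ p q = resp-≤ refl (cancel ∣ p - q ∣ ℚ.∣ q ∣)
    (ℚ.+-monoˡ-≤ (ℚ.- ℚ.∣ q ∣)
      (resp-≤ (cong ℚ.∣_∣ (eq p q)) refl (ℚ.∣p+q∣≤∣p∣+∣q∣ (p ℚ.- q) q)))
    where
    open +-*-Solver
    eq : ∀ p q → (p ℚ.- q) ℚ.+ q ≡ p
    eq = solve 2 (λ p q → (p :- q) :+ q := p) refl
    cancel : ∀ a b → a ℚ.+ b ℚ.- b ≡ a
    cancel = solve 2 (λ a b → (a :+ b) :- b := a) refl

  ∣∣-∣∣-≤ : ∀ p q → ∣ ℚ.∣ p ∣ - ℚ.∣ q ∣ ∣ ℚ.≤ ∣ p - q ∣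
  ∣∣-∣∣-≤ p q with ℚ.∣p∣≡p∨∣p∣≡-p (ℚ.∣ p ∣ ℚ.- ℚ.∣ q ∣)
  ... | inj₁ eq = resp-≤ (sym eq) refl (∣∣-∣∣≤ p q)
  ... | inj₂ eq = resp-≤ (trans flip (sym eq)) (∣-∣-comm q p) (∣∣-∣∣≤ q p)
    where
    open +-*-Solver
    flip : ℚ.∣ q ∣ ℚ.- ℚ.∣ p ∣ ≡ ℚ.- (ℚ.∣ p ∣ ℚ.- ℚ.∣ q ∣)
    flip = solve 2 (λ a b → b :- a := :- (a :- b)) refl ℚ.∣ p ∣ ℚ.∣ q ∣

  bounded : ∀ x → ∃[ K ] 0ℚ ℚ.< K × Eventually (λ n → ℚ.∣ seq x n ∣ ℚ.≤ K)
  bounded x with cauchy x 1ℚ (ℚ.positive⁻¹ 1ℚ)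
  ... | N , c = K , K>0 , N , λ n N≤n →
      ℚ.≤-trans (resp-≤ (cong ℚ.∣_∣ (eq (seq x n))) refl (ℚ.∣p+q∣≤∣p∣+∣q∣ (seq x n ℚ.- seq x N) (seq x N)))
                (ℚ.+-monoˡ-≤ ℚ.∣ seq x N ∣ (c n N N≤n ℕ.≤-refl))
    where
    open +-*-Solver
    K = 1ℚ ℚ.+ ℚ.∣ seq x N ∣
    K>0 : 0ℚ ℚ.< K
    K>0 = ℚ.+-mono-<-≤ (ℚ.positive⁻¹ 1ℚ) (ℚ.0≤∣p∣ (seq x N))
    eq : ∀ p → (p ℚ.- seq x N) ℚ.+ seq x N ≡ p
    eq p = solve 2 (λ p q → (p :- q) :+ q := p) refl p (seq x N)

  scale : ∀ {K ε} → 0ℚ ℚ.< K → 0ℚ ℚ.< ε →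
          ∃[ η ] 0ℚ ℚ.< η ×
            (∀ {u v} → ℚ.∣ u ∣ ℚ.≤ K → ℚ.∣ v ∣ ℚ.≤ η → ℚ.∣ u ∣ ℚ.* ℚ.∣ v ∣ ℚ.≤ ε)
  scale {K} {ε} K>0 ε>0 = η , ℚ.positive⁻¹ η {{η-pos}} , λ {u} {v} u≤ v≤ →
      ℚ.≤-trans (ℚ.*-monoˡ-≤-nonNeg ℚ.∣ u ∣ {{ℚ.∣-∣-nonNeg u}} v≤)
        (resp-≤ refl Kη≡ε (ℚ.*-monoʳ-≤-nonNeg η {{ℚ.pos⇒nonNeg η {{η-pos}}}} u≤))
    where
    instance
      K-pos : ℚ.Positive K
      K-pos = ℚ.positive K>0
      K-nonZero : ℚ.NonZero K
      K-nonZero = ℚ.pos⇒nonZero K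
      ε-pos : ℚ.Positive ε
      ε-pos = ℚ.positive ε>0
      1/K-pos : ℚ.Positive (ℚ.1/ K)
      1/K-pos = ℚ.1/pos⇒pos K
    η = ℚ.1/ K ℚ.* ε
    η-pos : ℚ.Positive η
    η-pos = ℚ.pos*pos⇒pos (ℚ.1/ K) ε
    Kη≡ε : K ℚ.* η ≡ ε
    Kη≡ε = trans (sym (ℚ.*-assoc K (ℚ.1/ K) ε))
             (trans (cong (ℚ._* ε) (ℚ.*-inverseʳ K)) (ℚ.*-identityˡ ε))

fromℚ : ℚ → ℝ
fromℚ q = record
  { seq    = λ _ → q
  ; cauchy = λ ε ε>0 → 0 , λ _ _ _ _ → ∣p-p∣≤ {q} refl ε>0
  }

0ℝ 1ℝ : ℝ
0ℝ = fromℚ 0ℚ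
1ℝ = fromℚ 1ℚ

infixl 6 _+ℝ_ _-ℝ_
infixl 7 _*ℝ_
infix  8 -ℝ_

_+ℝ_ : ℝ → ℝ → ℝ
x +ℝ y = record
  { seq    = λ n → seq x n ℚ.+ seq y n
  ; cauchy = λ ε ε>0 →
      let M , p = cauchy x (½ ℚ.* ε) (half>0 ε>0)
          N , q = cauchy y (½ ℚ.* ε) (half>0 ε>0)
      in M ℕ.⊔ N , λ m n m≥ n≥ →
           ≤halves (∣+∣-≤ (seq x m) (seq y m) (seq x n) (seq y n))
             (p m n (ℕ.≤-trans (ℕ.m≤m⊔n M N) m≥) (ℕ.≤-trans (ℕ.m≤m⊔n M N) n≥))
             (q m n (ℕ.≤-trans (ℕ.m≤n⊔m M N) m≥) (ℕ.≤-trans (ℕ.m≤n⊔m M N) n≥))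
  }

-ℝ_ : ℝ → ℝ
-ℝ x = record
  { seq    = λ n → ℚ.- seq x n
  ; cauchy = λ ε ε>0 →
      let N , p = cauchy x ε ε>0
      in N , λ m n m≥ n≥ →
           resp-≤ (trans (∣-∣-comm (seq x m) (seq x n))
             (cong ℚ.∣_∣ (eq (seq x m) (seq x n)))) refl (p m n m≥ n≥)
  }
  where
  open +-*-Solver
  eq : ∀ p q → q ℚ.- p ≡ (ℚ.- p) ℚ.- (ℚ.- q)
  eq = solve 2 (λ p q → q :- p := :- p :- (:- q)) refl

_-ℝ_ : ℝ → ℝ → ℝ
x -ℝ y = x +ℝ (-ℝ y)

∣_∣ℝ : ℝ → ℝ
∣ x ∣ℝ = record
  { seq    = λ n → ℚ.∣ seq x n ∣
  ; cauchy = λ ε ε>0 →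
      let N , p = cauchy x ε ε>0
      in N , λ m n m≥ n≥ → ℚ.≤-trans (∣∣-∣∣-≤ (seq x m) (seq x n)) (p m n m≥ n≥)
  }

_*ℝ_ : ℝ → ℝ → ℝ
x *ℝ y = record
  { seq    = λ n → seq x n ℚ.* seq y n
  ; cauchy = λ ε ε>0 →
      let K , K>0 , N₁ , x≤K = bounded x
          L , L>0 , N₂ , y≤L = bounded y
          η , η>0 , Kη = scale K>0 (half>0 ε>0)
          θ , θ>0 , Lθ = scale L>0 (half>0 ε>0)
          N₃ , p = cauchy y η η>0
          N₄ , q = cauchy x θ θ>0
          A = N₁ ℕ.⊔ N₂
          B = N₃ ℕ.⊔ N₄
          A≤ : A ℕ.≤ A ℕ.⊔ B
          A≤ = ℕ.m≤m⊔n A B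
          B≤ : B ℕ.≤ A ℕ.⊔ B
          B≤ = ℕ.m≤n⊔m A B
          N₁≤ = ℕ.≤-trans (ℕ.m≤m⊔n N₁ N₂) A≤
          N₂≤ = ℕ.≤-trans (ℕ.m≤n⊔m N₁ N₂) A≤
          N₃≤ = ℕ.≤-trans (ℕ.m≤m⊔n N₃ N₄) B≤
          N₄≤ = ℕ.≤-trans (ℕ.m≤n⊔m N₃ N₄) B≤
      in A ℕ.⊔ B , λ m n m≥ n≥ →
           ≤halves (∣*∣-≤ (seq x m) (seq y m) (seq x n) (seq y n))
             (Kη (x≤K m (ℕ.≤-trans N₁≤ m≥))
                 (p m n (ℕ.≤-trans N₃≤ m≥) (ℕ.≤-trans N₃≤ n≥)))
             (Lθ (y≤L n (ℕ.≤-trans N₂≤ n≥))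
                 (q m n (ℕ.≤-trans N₄≤ m≥) (ℕ.≤-trans N₄≤ n≥)))
  }

≡⇒≈ : ∀ x y → (∀ n → seq x n ≡ seq y n) → x ≈ℝ y
≡⇒≈ x y eq ε ε>0 = 0 , λ n _ → ∣p-p∣≤ (eq n) ε>0

≈-sym : ∀ x y → x ≈ℝ y → y ≈ℝ x
≈-sym x y x≈y ε ε>0 with x≈y ε ε>0
... | N , p = N , λ n le → resp-≤ (∣-∣-comm (seq x n) (seq y n)) refl (p n le)

≈-trans : ∀ x y z → x ≈ℝ y → y ≈ℝ z → x ≈ℝ z
≈-trans x y z x≈y y≈z ε ε>0 =
  both (λ {n} → ≤halves (triangle (seq x n) (seq y n) (seq z n)))
       (x≈y _ (half>0 ε>0)) (y≈z _ (half>0 ε>0))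

+ℝ-cong : ∀ x y u v → x ≈ℝ y → u ≈ℝ v → x +ℝ u ≈ℝ y +ℝ v
+ℝ-cong x y u v x≈y u≈v ε ε>0 =
  both (λ {n} → ≤halves (∣+∣-≤ (seq x n) (seq u n) (seq y n) (seq v n)))
       (x≈y _ (half>0 ε>0)) (u≈v _ (half>0 ε>0))

*ℝ-congˡ : ∀ z x y → x ≈ℝ y → z *ℝ x ≈ℝ z *ℝ y
*ℝ-congˡ z x y x≈y ε ε>0 =
  let K , K>0 , z≤K = bounded z
      η , η>0 , Kη  = scale K>0 ε>0
  in both (λ {n} z≤ x-y≤ → resp-≤
               (trans (sym (ℚ.∣p*q∣≡∣p∣*∣q∣ (seq z n) _)) (cong ℚ.∣_∣ (eq (seq z n) (seq x n) (seq y n))))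
               refl (Kη z≤ x-y≤))
          z≤K (x≈y η η>0)
  where
  open +-*-Solver
  eq : ∀ p q r → p ℚ.* (q ℚ.- r) ≡ p ℚ.* q ℚ.- p ℚ.* r
  eq = solve 3 (λ p q r → p :* (q :- r) := p :* q :- p :* r) refl

-- ℝ^Ω.  The finite state space Ω is Fin n throughout.
ℝ^ : ℕ → Set
ℝ^ n = Fin n → ℝ

_≋_ : ∀ {n} → ℝ^ n → ℝ^ n → Set
μ ≋ ν = ∀ t → μ t ≈ℝ ν t

sum : ∀ {n} → ℝ^ n → ℝ
sum = Vector.foldr _+ℝ_ 0ℝ

record 𝔻 {n : ℕ} (μ : ℝ^ n) : Set where
  field
    nonNegative : ∀ t → 0ℝ ≤ℝ μ t
    total       : sum μ ≈ℝ 1ℝ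

point : ∀ {n} → Fin n → ℝ^ n
point s t = if does (s Fin.≟ t) then 1ℝ else 0ℝ

Convex : ∀ {n} → Pred (ℝ^ n) 0ℓ → Set
Convex X = ∀ {μ ν} → X μ → X ν → ∀ p q → 0ℝ ≤ℝ p → 0ℝ ≤ℝ q → p +ℝ q ≈ℝ 1ℝ →
           X (λ t → p *ℝ μ t +ℝ q *ℝ ν t)

-- X contains every point at distance 0 from it; the topology of ℝ^Ω is that
-- of the maximum norm.  Such an X is automatically closed under ≋.
Closed : ∀ {n} → Pred (ℝ^ n) 0ℓ → Set
Closed X = ∀ {μ} →
  (∀ ε → 0ℚ ℚ.< ε → ∃[ ν ] X ν × (∀ t → ∣ μ t -ℝ ν t ∣ℝ ≤ℝ fromℚ ε)) → X μ

record ℍ₁ (n : ℕ) : Set₁ where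
  field
    map      : Fin n → Pred (ℝ^ n) 0ℓ
    ⊆𝔻       : ∀ s → map s ⊆ 𝔻
    nonEmpty : ∀ s → ∃ (map s)
    convex   : ∀ s → Convex (map s)
    closed   : ∀ s → Closed (map s)

record Test (n : ℕ) : Set₁ where
  field
    map    : Fin n → Pred (ℝ^ n) 0ℓ
    resp   : ∀ s {μ ν} → μ ≋ ν → map s μ → map s ν
    ⊆point : ∀ s → map s ⊆ (_≋ point s)

-- The union of ℍ₁ Ω with the tests.  An element is meant to be just its map;
-- a map that is both a program and a test has two names here, which ⊑ℍ does
-- not distinguish.
data ℍ̄₁ (n : ℕ) : Set₁ where
  program : ℍ₁ n → ℍ̄₁ n
  test    : Test n → ℍ̄₁ n

⟦_⟧ : ∀ {n} → ℍ̄₁ n → Fin n → Pred (ℝ^ n) 0ℓ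
⟦ program r ⟧ = ℍ₁.map r
⟦ test b ⟧    = Test.map b

infix 4 _⊑ℍ_

_⊑ℍ_ : ∀ {n} → ℍ̄₁ n → ℍ̄₁ n → Set
r ⊑ℍ r′ = ∀ s → ⟦ r ⟧ s ⊆ ⟦ r′ ⟧ s

private
  fromℚ-mono : ∀ {p q} → p ℚ.≤ q → fromℚ p ≤ℝ fromℚ q
  fromℚ-mono {p} {q} p≤q ε ε>0 = 0 , λ _ _ →
    resp-≤ (ℚ.+-identityʳ p) refl (ℚ.+-mono-≤ p≤q (ℚ.<⇒≤ ε>0))

  ≤-resp-≈ : ∀ x y z → y ≈ℝ z → x ≤ℝ y → x ≤ℝ z
  ≤-resp-≈ x y z y≈z x≤y ε ε>0 = both
    (λ {n} → bound (seq x n) (seq y n) (seq z n)) (x≤y _ (half>0 ε>0)) (y≈z _ (half>0 ε>0))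
    where
    open +-*-Solver
    bound : ∀ a b c → a ℚ.≤ b ℚ.+ ½ ℚ.* ε → ∣ b - c ∣ ℚ.≤ ½ ℚ.* ε → a ℚ.≤ c ℚ.+ ε
    bound a b c a≤ b-c≤ = ℚ.≤-trans a≤ (resp-≤ refl (trans (ℚ.+-assoc c _ _) (cong (c ℚ.+_) (halve ε)))
      (ℚ.+-monoˡ-≤ (½ ℚ.* ε)
        (resp-≤ (eq b c) refl (ℚ.+-monoʳ-≤ c (ℚ.≤-trans (p≤∣p∣ (b ℚ.- c)) b-c≤)))))
      where
      eq : ∀ b c → c ℚ.+ (b ℚ.- c) ≡ b
      eq = solve 2 (λ b c → c :+ (b :- c) := b) refl

  sum-cong : ∀ {n} (μ ν : ℝ^ n) → μ ≋ ν → sum μ ≈ℝ sum ν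
  sum-cong {zero}  μ ν μ≋ν = ≡⇒≈ 0ℝ 0ℝ (λ _ → refl)
  sum-cong {suc n} μ ν μ≋ν = +ℝ-cong (μ zero) (ν zero) (sum (μ ∘ suc)) (sum (ν ∘ suc)) (μ≋ν zero)
                               (sum-cong (μ ∘ suc) (ν ∘ suc) (μ≋ν ∘ suc))

  sum-0 : ∀ n → sum {n} (λ _ → 0ℝ) ≈ℝ 0ℝ
  sum-0 zero    = ≡⇒≈ 0ℝ 0ℝ (λ _ → refl)
  sum-0 (suc n) = +ℝ-cong 0ℝ 0ℝ (sum {n} (λ _ → 0ℝ)) 0ℝ (≡⇒≈ 0ℝ 0ℝ (λ _ → refl)) (sum-0 n)

  sum-point : ∀ {n} (s : Fin n) → sum (point s) ≈ℝ 1ℝ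
  sum-point {suc n} zero    =
    +ℝ-cong 1ℝ 1ℝ (sum {n} (λ _ → 0ℝ)) 0ℝ (≡⇒≈ 1ℝ 1ℝ (λ _ → refl)) (sum-0 n)
  sum-point {suc n} (suc s) =
    +ℝ-cong 0ℝ 0ℝ (sum (point s)) 1ℝ (≡⇒≈ 0ℝ 0ℝ (λ _ → refl)) (sum-point s)

  point≥0 : ∀ {n} (s t : Fin n) → 0ℝ ≤ℝ point s t
  point≥0 s t with s Fin.≟ t
  ... | yes _ = fromℚ-mono (ℚ.<⇒≤ (ℚ.positive⁻¹ 1ℚ))
  ... | no  _ = fromℚ-mono ℚ.≤-refl

  ≋point⇒𝔻 : ∀ {n} (s : Fin n) → (_≋ point s) ⊆ 𝔻
  ≋point⇒𝔻 s {μ} μ≋ = record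
    { nonNegative = λ t → ≤-resp-≈ 0ℝ (point s t) (μ t) (≈-sym (μ t) (point s t) (μ≋ t)) (point≥0 s t)
    ; total       = ≈-trans (sum μ) (sum (point s)) 1ℝ (sum-cong μ (point s) μ≋) (sum-point s)
    }

  convex-combination : ∀ p q x y z → p +ℝ q ≈ℝ 1ℝ → x ≈ℝ z → y ≈ℝ z →
                       p *ℝ x +ℝ q *ℝ y ≈ℝ z
  convex-combination p q x y z p+q≈1 x≈z y≈z =
    ≈-trans (p *ℝ x +ℝ q *ℝ y) (p *ℝ z +ℝ q *ℝ z) z
      (+ℝ-cong (p *ℝ x) (p *ℝ z) (q *ℝ y) (q *ℝ z) (*ℝ-congˡ p x z x≈z) (*ℝ-congˡ q y z y≈z))
    (≈-trans (p *ℝ z +ℝ q *ℝ z) (z *ℝ (p +ℝ q)) z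
      (≡⇒≈ (p *ℝ z +ℝ q *ℝ z) (z *ℝ (p +ℝ q)) (λ n → eq (seq p n) (seq q n) (seq z n)))
    (≈-trans (z *ℝ (p +ℝ q)) (z *ℝ 1ℝ) z
      (*ℝ-congˡ z (p +ℝ q) 1ℝ p+q≈1)
      (≡⇒≈ (z *ℝ 1ℝ) z (λ n → ℚ.*-identityʳ (seq z n)))))
    where
    open +-*-Solver
    eq : ∀ p q r → p ℚ.* r ℚ.+ q ℚ.* r ≡ r ℚ.* (p ℚ.+ q)
    eq = solve 3 (λ p q r → p :* r :+ q :* r := r :* (p :+ q)) refl

  limit : ∀ x z → (∀ ε → 0ℚ ℚ.< ε → ∃[ y ] y ≈ℝ z × ∣ x -ℝ y ∣ℝ ≤ℝ fromℚ ε) → x ≈ℝ z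
  limit x z approx ε ε>0 with approx (½ ℚ.* (½ ℚ.* ε)) (half>0 (half>0 ε>0))
  ... | y , y≈z , x-y≤ = both
    (λ {n} x-y y-z → ≤halves (triangle (seq x n) (seq y n) (seq z n))
                       (resp-≤ refl (halve (½ ℚ.* ε)) x-y) y-z)
    (x-y≤ (½ ℚ.* (½ ℚ.* ε)) (half>0 (half>0 ε>0))) (y≈z _ (half>0 ε>0))

δ : ∀ {n} → ℍ₁ n
δ = record
  { map      = λ s → _≋ point s
  ; ⊆𝔻       = ≋point⇒𝔻
  ; nonEmpty = λ s → point s , λ t → ≡⇒≈ (point s t) (point s t) (λ _ → refl)
  ; convex   = λ s {μ} {ν} μ≋ ν≋ p q _ _ p+q≈1 t →
      convex-combination p q (μ t) (ν t) (point s t) p+q≈1 (μ≋ t) (ν≋ t)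
  ; closed   = λ s {μ} approx t → limit (μ t) (point s t) λ ε ε>0 →
      let ν , ν≋ , close = approx ε ε>0 in ν t , ν≋ t , close t
  }

-- The powerset of A is Pred A 0ℓ, a subset being determined up to ≐; hence the two
-- fields ↦-resp and Φ-resp.
record IpBES (n : ℕ) : Set₂ where
  infix 4 _↦_ _#_
  field
    Event  : Set
    _↦_    : Pred Event 0ℓ → Event → Set₁
    _#_    : Rel Event (lsuc 0ℓ)
    label  : Event → ℍ̄₁ n
    Φ      : Pred (Pred Event 0ℓ) (lsuc 0ℓ)

  -- The relation x # x between a set of events and itself.
  SelfConflict : Pred Event 0ℓ → Set₁
  SelfConflict x = ∀ {e e′} → x e → x e′ → e ≢ e′ → e # e′

  field
    #-irrefl   : ∀ {e} → ¬ e # e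
    #-sym      : ∀ {e e′} → e # e′ → e′ # e
    ↦-conflict : ∀ {x e} → x ↦ e → SelfConflict x
    Φ-conflict : ∀ {x} → Φ x → SelfConflict x
    ↦-resp     : ∀ {x y e} → x ≐ y → x ↦ e → y ↦ e
    Φ-resp     : ∀ {x y} → x ≐ y → Φ x → Φ y

  Initial : Pred Event (lsuc 0ℓ)
  Initial e = ∀ x → ¬ x ↦ e

  -- The structure 0, up to the choice of the empty type of events.
  IsZero : Set₁
  IsZero = ¬ Event × (∀ x → ¬ Φ x)

open IpBES using (Event; Initial; IsZero)

module _ {n : ℕ} where

  record IsTrace (ℰ : IpBES n) (α : List (Event ℰ)) : Set₁ where
    open IpBES ℰ using (_↦_; _#_)
    field
      distinct     : Unique α
      conflictFree : AllPairs (λ e e′ → ¬ e # e′) α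
      secured      : ∀ β e γ → α ≡ β ++ e ∷ γ → ∀ x → x ↦ e → Any x β

  -- 𝒯(ℰ).  The proof is irrelevant, so traces are equal when their event
  -- sequences are.
  record Trace (ℰ : IpBES n) : Set₁ where
    constructor trace
    field
      events   : List (Event ℰ)
      .isTrace : IsTrace ℰ events

  open Trace using (events) public

  ∅ₜ : ∀ {ℰ} → Trace ℰ
  ∅ₜ = trace [] record
    { distinct     = []
    ; conflictFree = []
    ; secured      = λ { [] _ _ () ; (_ ∷ _) _ _ () }
    }

  Maximal : ∀ {ℰ} → Trace ℰ → Set₁
  Maximal {ℰ} α = ∀ (β : Trace ℰ) γ → events β ≡ events α ++ γ → γ ≡ []

  WeaklyMaximal : ∀ {ℰ} → Trace ℰ → Set₁
  WeaklyMaximal {ℰ} α = Maximal α ⊎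
    (∃[ β ] ∃[ es ] events β ≡ events α ++ es × Maximal {ℰ} β ×
       All (λ e → program δ ⊑ℍ IpBES.label ℰ e) es)

  Finite : ∀ {a p} {A : Set a} → Pred A p → Set (a ⊔ p)
  Finite {A = A} P = ∃[ xs ] (∀ {x : A} → P x → x ∈ xs)

  record IsTSimulation (ℰ ℱ : IpBES n) (f : Trace ℰ → Trace ℱ) : Set₁ where
    private
      module ℰ = IpBES ℰ
      module ℱ = IpBES ℱ
    field
      empty    : f ∅ₜ ≡ ∅ₜ
      finite   : ∀ β → Finite (λ α → f α ≡ β)
      step     : ∀ α e αe → events αe ≡ events α ∷ʳ e →
                 (f αe ≡ f α × ℰ.label e ⊑ℍ program δ) ⊎
                 (∃[ e′ ] ℰ.label e ⊑ℍ ℱ.label e′ × events (f αe) ≡ events (f α) ∷ʳ e′)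
      stepMax  : ∀ α e αe → events αe ≡ events α ∷ʳ e → Maximal αe →
                 (∃[ e′ ] events (f αe) ≡ events (f α) ∷ʳ e′ × ℰ.label e ⊑ℍ ℱ.label e′) ×
                 WeaklyMaximal (f αe)

  infix 3 _⊑sim_

  _⊑sim_ : IpBES n → IpBES n → Set₁
  ℰ ⊑sim ℱ = ∃[ f ] IsTSimulation ℰ ℱ f

left : {A B : Set} → Pred A 0ℓ → Pred (A ⊎ B) 0ℓ
left x = [ x , ∅ ]′

right : {A B : Set} → Pred B 0ℓ → Pred (A ⊎ B) 0ℓ
right y = [ ∅ , y ]′

≐-sym : {A : Set} {x y : Pred A 0ℓ} → x ≐ y → y ≐ x
≐-sym (f , g) = g , f

≐-trans : {A : Set} {x y z : Pred A 0ℓ} → x ≐ y → y ≐ z → x ≐ z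
≐-trans (f , g) (f′ , g′) = f′ ∘ f , g ∘ g′

atom : ∀ {n} → ℍ̄₁ n → IpBES n
atom a = record
  { Event      = ⊤
  ; _↦_        = λ _ _ → ⊥₁
  ; _#_        = λ _ _ → ⊥₁
  ; label      = λ _ → a
  ; Φ          = λ x → Lift₁ (x ≐ ｛ tt ｝)
  ; #-irrefl   = λ ()
  ; #-sym      = λ ()
  ; ↦-conflict = λ ()
  ; Φ-conflict = λ _ _ _ tt≢tt → ⊥-elim (tt≢tt refl)
  ; ↦-resp     = λ _ ()
  ; Φ-resp     = λ { x≐y (lift p) → lift (≐-trans (≐-sym x≐y) p) }
  }
  where
  Lift₁ : Set → Set₁
  Lift₁ = Lift (lsuc 0ℓ)
  ⊥₁ : Set₁
  ⊥₁ = Lift₁ ⊥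

𝟙 : ∀ {n} → IpBES n
𝟙 = atom (program δ)

module _ {n : ℕ} (ℰ ℱ : IpBES n) where
  private
    module ℰ = IpBES ℰ
    module ℱ = IpBES ℱ
    E = ℰ.Event
    F = ℱ.Event

  data Bundle (z : Pred (E ⊎ F) 0ℓ) : E ⊎ F → Set₁ where
    inˡ : ∀ {x e} → x ℰ.↦ e → z ≐ left  x → Bundle z (inj₁ e)
    inʳ : ∀ {y f} → y ℱ.↦ f → z ≐ right y → Bundle z (inj₂ f)

  Conflict : Rel (E ⊎ F) (lsuc 0ℓ)
  Conflict = Pointwise ℰ._#_ ℱ._#_

  Label : E ⊎ F → ℍ̄₁ n
  Label = [ ℰ.label , ℱ.label ]′

  data +-Conflict : Rel (E ⊎ F) (lsuc 0ℓ) where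
    operand  : ∀ {d d′} → Conflict d d′ → +-Conflict d d′
    initial  : ∀ {e f} → ℰ.Initial e → ℱ.Initial f → +-Conflict (inj₁ e) (inj₂ f)
    initial˘ : ∀ {e f} → ℰ.Initial e → ℱ.Initial f → +-Conflict (inj₂ f) (inj₁ e)
    exit     : ∀ {e f x y} → ℰ.Φ x → ℱ.Φ y → x e → y f → +-Conflict (inj₁ e) (inj₂ f)
    exit˘    : ∀ {e f x y} → ℰ.Φ x → ℱ.Φ y → x e → y f → +-Conflict (inj₂ f) (inj₁ e)

  -- The clauses zeroˡ and zeroʳ implement ℰ + 0 = ℰ and 0 + ℱ = ℱ: when one
  -- operand is 0, all other components of the sum are already those of the
  -- other operand.
  data +-Exit (z : Pred (E ⊎ F) 0ℓ) : Set₁ where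
    union : ∀ {x y} → ℰ.Φ x → ℱ.Φ y → z ≐ [ x , y ]′ → +-Exit z
    zeroˡ : ∀ {y} → ℰ.IsZero → ℱ.Φ y → z ≐ right y → +-Exit z
    zeroʳ : ∀ {x} → ℱ.IsZero → ℰ.Φ x → z ≐ left  x → +-Exit z

  data ·-Bundle (z : Pred (E ⊎ F) 0ℓ) : E ⊎ F → Set₁ where
    operand : ∀ {d} → Bundle z d → ·-Bundle z d
    next    : ∀ {x f} → ℰ.Φ x → ℱ.Initial f → z ≐ left x → ·-Bundle z (inj₂ f)

  -- zeroʳ implements ℰ · 0 = ℰ; 0 · ℱ = ℱ holds without a further clause.
  data ·-Exit (z : Pred (E ⊎ F) 0ℓ) : Set₁ where
    last  : ∀ {y} → ℱ.Φ y → z ≐ right y → ·-Exit z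
    zeroʳ : ∀ {x} → ℱ.IsZero → ℰ.Φ x → z ≐ left x → ·-Exit z

  data ∥-Exit (z : Pred (E ⊎ F) 0ℓ) : Set₁ where
    inˡ : ∀ {x} → ℰ.Φ x → z ≐ left  x → ∥-Exit z
    inʳ : ∀ {y} → ℱ.Φ y → z ≐ right y → ∥-Exit z

  private
    irrefl : ∀ {d} → ¬ Conflict d d
    irrefl (inj₁ p) = ℰ.#-irrefl p
    irrefl (inj₂ p) = ℱ.#-irrefl p

    symm : ∀ {d d′} → Conflict d d′ → Conflict d′ d
    symm (inj₁ p) = inj₁ (ℰ.#-sym p)
    symm (inj₂ p) = inj₂ (ℱ.#-sym p)

    left-conflict : ∀ {z : Pred (E ⊎ F) 0ℓ} {x} → ℰ.SelfConflict x → z ≐ left x →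
                    ∀ {d d′} → z d → z d′ → d ≢ d′ → Conflict d d′
    left-conflict c (z⊆ , _) {d} {d′} p q ne with d | d′ | z⊆ p | z⊆ q
    ... | inj₁ e | inj₁ e′ | p′ | q′ = inj₁ (c p′ q′ (ne ∘ cong Sum.inj₁))

    right-conflict : ∀ {z : Pred (E ⊎ F) 0ℓ} {y} → ℱ.SelfConflict y → z ≐ right y →
                     ∀ {d d′} → z d → z d′ → d ≢ d′ → Conflict d d′
    right-conflict c (z⊆ , _) {d} {d′} p q ne with d | d′ | z⊆ p | z⊆ q
    ... | inj₂ f | inj₂ f′ | p′ | q′ = inj₂ (c p′ q′ (ne ∘ cong Sum.inj₂))

    bundle-conflict : ∀ {z d₀} → Bundle z d₀ →
                      ∀ {d d′} → z d → z d′ → d ≢ d′ → Conflict d d′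
    bundle-conflict (inˡ b z≐) = left-conflict  (ℰ.↦-conflict b) z≐
    bundle-conflict (inʳ b z≐) = right-conflict (ℱ.↦-conflict b) z≐

    bundle-resp : ∀ {z w d} → z ≐ w → Bundle z d → Bundle w d
    bundle-resp z≐w (inˡ b z≐) = inˡ b (≐-trans (≐-sym z≐w) z≐)
    bundle-resp z≐w (inʳ b z≐) = inʳ b (≐-trans (≐-sym z≐w) z≐)

  infixl 6 _+_
  infixl 7 _·_
  infixl 5 _∥_

  _+_ : IpBES n
  _+_ = record
    { Event      = E ⊎ F
    ; _↦_        = Bundle
    ; _#_        = +-Conflict
    ; label      = Label
    ; Φ          = +-Exit
    ; #-irrefl   = λ { (operand p) → irrefl p }
    ; #-sym      = λ { (operand p)     → operand (symm p)
                     ; (initial i j)   → initial˘ i j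
                     ; (initial˘ i j)  → initial i j
                     ; (exit x y p q)  → exit˘ x y p q
                     ; (exit˘ x y p q) → exit x y p q }
    ; ↦-conflict = λ b p q ne → operand (bundle-conflict b p q ne)
    ; Φ-conflict = exit-conflict
    ; ↦-resp     = bundle-resp
    ; Φ-resp     = λ { z≐w (union x y z≐) → union x y (≐-trans (≐-sym z≐w) z≐)
                     ; z≐w (zeroˡ o y z≐) → zeroˡ o y (≐-trans (≐-sym z≐w) z≐)
                     ; z≐w (zeroʳ o x z≐) → zeroʳ o x (≐-trans (≐-sym z≐w) z≐) }
    }
    where
    exit-conflict : ∀ {z} → +-Exit z → ∀ {d d′} → z d → z d′ → d ≢ d′ → +-Conflict d d′
    exit-conflict (union x y (z⊆ , _)) {d} {d′} p q ne with d | d′ | z⊆ p | z⊆ q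
    ... | inj₁ e | inj₁ e′ | p′ | q′ = operand (inj₁ (ℰ.Φ-conflict x p′ q′ (ne ∘ cong Sum.inj₁)))
    ... | inj₁ e | inj₂ f  | p′ | q′ = exit x y p′ q′
    ... | inj₂ f | inj₁ e  | p′ | q′ = exit˘ x y q′ p′
    ... | inj₂ f | inj₂ f′ | p′ | q′ = operand (inj₂ (ℱ.Φ-conflict y p′ q′ (ne ∘ cong Sum.inj₂)))
    exit-conflict (zeroˡ _ y z≐) p q ne = operand (right-conflict (ℱ.Φ-conflict y) z≐ p q ne)
    exit-conflict (zeroʳ _ x z≐) p q ne = operand (left-conflict  (ℰ.Φ-conflict x) z≐ p q ne)

  _·_ : IpBES n
  _·_ = record
    { Event      = E ⊎ F
    ; _↦_        = ·-Bundle
    ; _#_        = Conflict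
    ; label      = Label
    ; Φ          = ·-Exit
    ; #-irrefl   = irrefl
    ; #-sym      = symm
    ; ↦-conflict = λ { (operand b)   → bundle-conflict b
                     ; (next x _ z≐) → left-conflict (ℰ.Φ-conflict x) z≐ }
    ; Φ-conflict = λ { (last y z≐)    → right-conflict (ℱ.Φ-conflict y) z≐
                     ; (zeroʳ _ x z≐) → left-conflict  (ℰ.Φ-conflict x) z≐ }
    ; ↦-resp     = λ { z≐w (operand b)   → operand (bundle-resp z≐w b)
                     ; z≐w (next x i z≐) → next x i (≐-trans (≐-sym z≐w) z≐) }
    ; Φ-resp     = λ { z≐w (last y z≐)    → last y (≐-trans (≐-sym z≐w) z≐)
                     ; z≐w (zeroʳ o x z≐) → zeroʳ o x (≐-trans (≐-sym z≐w) z≐) }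
    }

  _∥_ : IpBES n
  _∥_ = record
    { Event      = E ⊎ F
    ; _↦_        = Bundle
    ; _#_        = Conflict
    ; label      = Label
    ; Φ          = ∥-Exit
    ; #-irrefl   = irrefl
    ; #-sym      = symm
    ; ↦-conflict = bundle-conflict
    ; Φ-conflict = λ { (inˡ x z≐) → left-conflict  (ℰ.Φ-conflict x) z≐
                     ; (inʳ y z≐) → right-conflict (ℱ.Φ-conflict y) z≐ }
    ; ↦-resp     = bundle-resp
    ; Φ-resp     = λ { z≐w (inˡ x z≐) → inˡ x (≐-trans (≐-sym z≐w) z≐)
                     ; z≐w (inʳ y z≐) → inʳ y (≐-trans (≐-sym z≐w) z≐) }
    }

  -- (k , inj₁ e) and (k , inj₂ f) are the events of the copies ℰₖ and ℱₖ.
  *-Event : Set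
  *-Event = ℕ × (E ⊎ F)

  copy : ℕ → Pred (E ⊎ F) 0ℓ → Pred *-Event 0ℓ
  copy k w (j , d) = j ≡ k × w d

  data *-Bundle (z : Pred *-Event 0ℓ) : *-Event → Set₁ where
    operand : ∀ {k w d} → Bundle w d → z ≐ copy k w → *-Bundle z (k , d)
    nextˡ   : ∀ {k x e} → ℰ.Φ x → ℰ.Initial e → z ≐ copy k (left x) → *-Bundle z (suc k , inj₁ e)
    nextʳ   : ∀ {k x f} → ℰ.Φ x → ℱ.Initial f → z ≐ copy k (left x) → *-Bundle z (suc k , inj₂ f)

  data *-Conflict : Rel *-Event (lsuc 0ℓ) where
    operand  : ∀ {k d d′} → Conflict d d′ → *-Conflict (k , d) (k , d′)
    initial  : ∀ {k e f} → ℰ.Initial e → ℱ.Initial f → *-Conflict (k , inj₁ e) (k , inj₂ f)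
    initial˘ : ∀ {k e f} → ℰ.Initial e → ℱ.Initial f → *-Conflict (k , inj₂ f) (k , inj₁ e)
    exit     : ∀ {j k f f′ x y} → j ≢ k → ℱ.Φ x → ℱ.Φ y → x f → y f′ →
               *-Conflict (j , inj₂ f) (k , inj₂ f′)

  *-Exit : Pred (Pred *-Event 0ℓ) (lsuc 0ℓ)
  *-Exit z = ∃ λ (y : ℕ → Pred F 0ℓ) →
    (∀ k → ℱ.Φ (y k)) × z ≐ (λ (k , d) → right (y k) d)

  infixl 8 _*_

  -- The explicit description of the limit of ℱ, ℱ + ℰ · ℱ, …, which is meant
  -- for ℰ ≠ 0.
  _*_ : IpBES n
  _*_ = record
    { Event      = *-Event
    ; _↦_        = *-Bundle
    ; _#_        = *-Conflict
    ; label      = λ (_ , d) → Label d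
    ; Φ          = *-Exit
    ; #-irrefl   = λ { (operand p)        → irrefl p
                     ; (exit j≢j _ _ _ _) → j≢j refl }
    ; #-sym      = λ { (operand p)        → operand (symm p)
                     ; (initial i j)      → initial˘ i j
                     ; (initial˘ i j)     → initial i j
                     ; (exit ne x y p q)  → exit (ne ∘ sym) y x q p }
    ; ↦-conflict = λ { (operand b z≐)  → copy-conflict (bundle-conflict b) z≐
                     ; (nextˡ x _ z≐) → copy-conflict (left-conflict (ℰ.Φ-conflict x) ≐-refl) z≐
                     ; (nextʳ x _ z≐) → copy-conflict (left-conflict (ℰ.Φ-conflict x) ≐-refl) z≐ }
    ; Φ-conflict = exit-conflict
    ; ↦-resp     = λ { z≐w (operand b z≐)  → operand b (≐-trans (≐-sym z≐w) z≐)
                     ; z≐w (nextˡ x i z≐) → nextˡ x i (≐-trans (≐-sym z≐w) z≐)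
                     ; z≐w (nextʳ x i z≐) → nextʳ x i (≐-trans (≐-sym z≐w) z≐) }
    ; Φ-resp     = λ { z≐w (y , Φy , z≐) → y , Φy , ≐-trans (≐-sym z≐w) z≐ }
    }
    where
    ≐-refl : {w : Pred (E ⊎ F) 0ℓ} → w ≐ w
    ≐-refl = (λ p → p) , (λ p → p)

    copy-conflict : ∀ {z k w} → (∀ {d d′} → w d → w d′ → d ≢ d′ → Conflict d d′) →
                    z ≐ copy k w → ∀ {d d′} → z d → z d′ → d ≢ d′ → *-Conflict d d′
    copy-conflict c (z⊆ , _) p q ne with z⊆ p | z⊆ q
    ... | refl , p′ | refl , q′ = operand (c p′ q′ (ne ∘ cong (_ ,_)))

    exit-conflict : ∀ {z} → *-Exit z → ∀ {d d′} → z d → z d′ → d ≢ d′ → *-Conflict d d′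
    exit-conflict (y , Φy , z⊆ , _) {j , d} {k , d′} p q ne with d | d′ | z⊆ p | z⊆ q
    ... | inj₂ f | inj₂ f′ | p′ | q′ with j ℕ.≟ k
    ...   | yes refl = operand (inj₂ (ℱ.Φ-conflict (Φy j) p′ q′ (ne ∘ cong (λ f → j , inj₂ f))))
    ...   | no j≢k   = exit j≢k (Φy j) (Φy k) p′ q′

infix 9 _⋆

_⋆ : ∀ {n} → ℍ₁ n → IpBES n
r ⋆ = atom (program r) * 𝟙

{-# OPTIONS --safe #-}
module Submission where

-- A trace of a * 𝒯 iterates a some k times and then continues as a trace of 𝒯 in copy k, so r ⋆ runs
-- r^k or r^k 1.
--
-- For r ⋆ ∥ r ⋆ ⊑ r ⋆, the iterations of both sides are renumbered into a single count, the first 1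
-- is dropped and the second one ends the loop.
--
-- For the other three inequalities, a trace of r ⋆ ∥ 𝒢 is sent to a trace of r * 𝒯 by counting the
-- k iterations before the first event of 𝒢 and running the remaining events inside copy k, which
-- contains its own r ⋆.  This map is invertible event by event except that a 1 preceding the first
-- event of 𝒢 is dropped.  In that case the image of a maximal trace is only weakly maximal: it lacks
-- the 1 of the inner r ⋆.

open import Defs
open import Data.Bool.Base using (Bool; true; false)
open import Data.Empty using (⊥-elim; ⊥-elim-irr)
open import Data.List.Base using (List; []; _∷_; _++_; _∷ʳ_; map; mapMaybe; length)
open import Data.List.Membership.Propositional using (_∈_; _∉_; find; lose)
open import Data.List.Membership.Propositional.Properties
open import Data.List.Properties
open import Data.List.Relation.Unary.All as All using (All; []; _∷_)
import Data.List.Relation.Unary.All.Properties as All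
open import Data.List.Relation.Unary.AllPairs as AllPairs using (AllPairs; []; _∷_)
import Data.List.Relation.Unary.AllPairs.Properties as AllPairs
open import Data.List.Relation.Unary.Any using (Any; here; there)
open import Data.List.Reverse using (Reverse; reverseView; _∶_∶ʳ_; [])
open import Data.Nat.Base as ℕ using (ℕ; zero; suc; _<_; _≤_)
import Data.Nat.Properties as ℕ
open import Data.Product.Base using (∃-syntax; _×_; _,_; proj₁; proj₂)
open import Data.Sum as Sum using (_⊎_; reduce; inj₁; inj₂; [_,_]′; isInj₁; isInj₂)
open import Data.Sum.Relation.Binary.Pointwise using (inj₁; inj₂)
open import Data.Unit.Base using (⊤; tt)
open import Function.Base using (_∘_; id)
open import Level using (lift)
open import Relation.Binary.PropositionalEquality
open import Relation.Nullary.Decidable using (Dec; yes; no; map′; recompute)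
open import Relation.Nullary.Negation.Core using (¬_)

open IpBES using (Event; Initial)

-- The maps are constrained by prefixes: `step` lets the image grow by at most one event at its end,
-- so a 1 that comes too early cannot be delayed. It can only be dropped, which `step` permits for
-- events below `δ`. On the other hand `stepMax` forbids dropping the last event of a maximal trace.
-- Hence of two 1s it is the later one that survives, and next to 𝒢 a 1 may be dropped only while 𝒢
-- has not begun: 𝒢 can always begin, so no maximal trace ends there.
--
-- The second obstacle is that a `Trace` hides its proof as irrelevant, while being a trace cannot
-- be decided for arbitrary ℰ and ℱ. All data is therefore computed from the event lists and from
-- the loop part, which is decidable. Finiteness of the fibres is not automatic either, as each
-- event of a loop has infinitely many copies; it holds because the copy numbers are forced by the
-- count of iterations.

module _ {a r} {A : Set a} {R : A → A → Set r} where

  AllPairs-∷ʳ⁻ : ∀ xs {x} → AllPairs R (xs ∷ʳ x) → AllPairs R xs × All (λ y → R y x) xs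
  AllPairs-∷ʳ⁻ []       _        = [] , []
  AllPairs-∷ʳ⁻ (y ∷ xs) (p ∷ ps) =
    let ps′ , qs = AllPairs-∷ʳ⁻ xs ps
        p′ , q   = All.∷ʳ⁻ p
    in p′ ∷ ps′ , q ∷ qs

  AllPairs-∷ʳ⁺ : ∀ {xs x} → AllPairs R xs → All (λ y → R y x) xs → AllPairs R (xs ∷ʳ x)
  AllPairs-∷ʳ⁺ ps qs = AllPairs.++⁺ ps ([] ∷ []) (All.map (_∷ []) qs)

map-∷ʳ : ∀ {a b} {A : Set a} {B : Set b} (f : A → B) xs {x} → map f (xs ∷ʳ x) ≡ map f xs ∷ʳ f x
map-∷ʳ f xs {x} = map-++ f xs (x ∷ [])

-- The two sides of an interleaving

module _ {A B : Set} where

  lefts : List (A ⊎ B) → List A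
  lefts = mapMaybe isInj₁

  rights : List (A ⊎ B) → List B
  rights = mapMaybe isInj₂

  lefts-++ : ∀ α β → lefts (α ++ β) ≡ lefts α ++ lefts β
  lefts-++ []           β = refl
  lefts-++ (inj₁ a ∷ α) β = cong (a ∷_) (lefts-++ α β)
  lefts-++ (inj₂ b ∷ α) β = lefts-++ α β

  rights-++ : ∀ α β → rights (α ++ β) ≡ rights α ++ rights β
  rights-++ []           β = refl
  rights-++ (inj₁ a ∷ α) β = rights-++ α β
  rights-++ (inj₂ b ∷ α) β = cong (b ∷_) (rights-++ α β)

  ∈-lefts⁺ : ∀ {α a} → inj₁ a ∈ α → a ∈ lefts α
  ∈-lefts⁺ (here refl) = here refl
  ∈-lefts⁺ {inj₁ _ ∷ _} (there a∈) = there (∈-lefts⁺ a∈)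
  ∈-lefts⁺ {inj₂ _ ∷ _} (there a∈) = ∈-lefts⁺ a∈

  ∈-lefts⁻ : ∀ α {a} → a ∈ lefts α → inj₁ a ∈ α
  ∈-lefts⁻ (inj₁ _ ∷ α) (here refl) = here refl
  ∈-lefts⁻ (inj₁ _ ∷ α) (there a∈) = there (∈-lefts⁻ α a∈)
  ∈-lefts⁻ (inj₂ _ ∷ α) a∈         = there (∈-lefts⁻ α a∈)

  ∈-rights⁺ : ∀ {α b} → inj₂ b ∈ α → b ∈ rights α
  ∈-rights⁺ (here refl) = here refl
  ∈-rights⁺ {inj₂ _ ∷ _} (there b∈) = there (∈-rights⁺ b∈)
  ∈-rights⁺ {inj₁ _ ∷ _} (there b∈) = ∈-rights⁺ b∈

  ∈-rights⁻ : ∀ α {b} → b ∈ rights α → inj₂ b ∈ α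
  ∈-rights⁻ (inj₂ _ ∷ α) (here refl) = here refl
  ∈-rights⁻ (inj₂ _ ∷ α) (there b∈) = there (∈-rights⁻ α b∈)
  ∈-rights⁻ (inj₁ _ ∷ α) b∈         = there (∈-rights⁻ α b∈)

-- Traces as paths

module _ {n : ℕ} where

  record Enabled (ℰ : IpBES n) (α : List (Event ℰ)) (e : Event ℰ) : Set₁ where
    open IpBES ℰ using (_↦_; _#_)
    field
      fresh      : e ∉ α
      compatible : ∀ {d} → d ∈ α → ¬ d # e
      enabled    : ∀ x → x ↦ e → ∃[ d ] d ∈ α × x d

  open Enabled

  infixl 5 _▷_

  -- Paths grow at the end because the conditions on a t-simulation compare a trace with its
  -- extension by one event. `IsTrace` speaks of all splittings of the list instead, which does not
  -- suit induction.
  data Path (ℰ : IpBES n) : List (Event ℰ) → Set₁ where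
    []  : Path ℰ []
    _▷_ : ∀ {α e} → Path ℰ α → Enabled ℰ α e → Path ℰ (α ∷ʳ e)

  path⇒trace : ∀ {ℰ α} → Path ℰ α → IsTrace ℰ α
  path⇒trace []                       = record
    { distinct     = []
    ; conflictFree = []
    ; secured      = λ { [] _ _ () ; (_ ∷ _) _ _ () }
    }
  path⇒trace {ℰ} (_▷_ {α} {e} p en) = record
    { distinct     = AllPairs-∷ʳ⁺ (distinct t) (All.tabulate λ { d∈α refl → fresh en d∈α })
    ; conflictFree = AllPairs-∷ʳ⁺ (conflictFree t) (All.tabulate (compatible en))
    ; secured      = λ β d γ → secured-∷ʳ β d γ (reverseView γ)
    }
    where
    open IsTrace
    open IpBES ℰ using (_↦_)
    t = path⇒trace p
    secured-∷ʳ : ∀ β d γ → Reverse γ → α ∷ʳ e ≡ β ++ d ∷ γ →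
                 ∀ x → x ↦ d → Any x β
    secured-∷ʳ β d .[] [] eq x b with refl , refl ← ∷ʳ-injective α β eq =
      let _ , d∈ , xd = enabled en x b in lose d∈ xd
    secured-∷ʳ β d .(γ ∷ʳ g) (γ ∶ _ ∶ʳ g) eq =
      secured t β d γ (∷ʳ-injectiveˡ α (β ++ d ∷ γ) (trans eq (sym (++-assoc β (d ∷ γ) (g ∷ [])))))

  trace⇒path : ∀ {ℰ α} → IsTrace ℰ α → Path ℰ α
  trace⇒path {ℰ} {α} = go (reverseView α)
    where
    open IsTrace
    go : ∀ {α} → Reverse α → IsTrace ℰ α → Path ℰ α
    go []             _ = []
    go (α ∶ rs ∶ʳ e) t = go rs t′ ▷ record
      { fresh      = λ e∈ → All.lookup (proj₂ (AllPairs-∷ʳ⁻ α (distinct t))) e∈ refl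
      ; compatible = All.lookup (proj₂ (AllPairs-∷ʳ⁻ α (conflictFree t)))
      ; enabled    = λ x b → find (secured t α e [] refl x b)
      }
      where
      t′ : IsTrace ℰ α
      t′ = record
        { distinct     = proj₁ (AllPairs-∷ʳ⁻ α (distinct t))
        ; conflictFree = proj₁ (AllPairs-∷ʳ⁻ α (conflictFree t))
        ; secured      = λ β d γ eq → secured t β d (γ ∷ʳ e)
            (trans (cong (_∷ʳ e) eq) (++-assoc β (d ∷ γ) (e ∷ [])))
        }

  head-initial : ∀ {ℰ e α} → Path ℰ (e ∷ α) → Initial ℰ e
  head-initial p x b with () ← IsTrace.secured (path⇒trace p) [] _ _ refl x b

  snoc-path : ∀ {ℰ α e β} → Path ℰ α → Enabled ℰ α e → β ≡ α ∷ʳ e → Path ℰ β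
  snoc-path p en refl = p ▷ en

  -- Traces of composite structures

  atom-sound : ∀ {a α} → Path (atom a) α → α ≡ [] ⊎ α ≡ tt ∷ []
  atom-sound []       = inj₁ refl
  atom-sound (p ▷ en) with atom-sound p
  ... | inj₁ refl = inj₂ refl
  ... | inj₂ refl = ⊥-elim (fresh en (here refl))

  atom-initial : ∀ {a} → Path (atom a) (tt ∷ [])
  atom-initial = [] ▷ record { fresh = λ () ; compatible = λ () ; enabled = λ _ () }

  ∥-lefts : ∀ {ℰ ℱ} {α : List (Event ℰ ⊎ Event ℱ)} → Path (ℰ ∥ ℱ) α → Path ℰ (lefts α)
  ∥-lefts []                           = []
  ∥-lefts (_▷_ {α} {inj₁ _} p en) = snoc-path (∥-lefts p) record
    { fresh      = λ e∈ → fresh en (∈-lefts⁻ α e∈)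
    ; compatible = λ d∈ c → compatible en (∈-lefts⁻ α d∈) (inj₁ c)
    ; enabled    = λ x b → case₁ (enabled en (left x) (inˡ b (id , id)))
    } (lefts-++ α _)
    where
    case₁ : ∀ {x} → ∃[ d ] d ∈ α × left x d → ∃[ d ] d ∈ lefts α × x d
    case₁ (inj₁ d , d∈ , xd) = d , ∈-lefts⁺ d∈ , xd
  ∥-lefts {ℰ} (_▷_ {α} {inj₂ _} p _) =
    subst (Path ℰ) (sym (trans (lefts-++ α _) (++-identityʳ _))) (∥-lefts p)

  ∥-rights : ∀ {ℰ ℱ} {α : List (Event ℰ ⊎ Event ℱ)} → Path (ℰ ∥ ℱ) α → Path ℱ (rights α)
  ∥-rights []                           = []
  ∥-rights (_▷_ {α} {inj₂ _} p en) = snoc-path (∥-rights p) record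
    { fresh      = λ e∈ → fresh en (∈-rights⁻ α e∈)
    ; compatible = λ d∈ c → compatible en (∈-rights⁻ α d∈) (inj₂ c)
    ; enabled    = λ x b → case₂ (enabled en (right x) (inʳ b (id , id)))
    } (rights-++ α _)
    where
    case₂ : ∀ {x} → ∃[ d ] d ∈ α × right x d → ∃[ d ] d ∈ rights α × x d
    case₂ (inj₂ d , d∈ , xd) = d , ∈-rights⁺ d∈ , xd
  ∥-rights {_} {ℱ} (_▷_ {α} {inj₁ _} p _) =
    subst (Path ℱ) (sym (trans (rights-++ α _) (++-identityʳ _))) (∥-rights p)

  ▷⁻ : ∀ {ℰ} α {e} → Path ℰ (α ∷ʳ e) → Path ℰ α × Enabled ℰ α e
  ▷⁻ {ℰ} α {e} p = go p refl
    where
    ≢[] : ∀ xs → xs ∷ʳ e ≢ []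
    ≢[] []      ()
    ≢[] (_ ∷ _) ()
    go : ∀ {β} → Path ℰ β → α ∷ʳ e ≡ β → Path ℰ α × Enabled ℰ α e
    go []               eq = ⊥-elim (≢[] α eq)
    go (_▷_ {β} p en) eq with refl , refl ← ∷ʳ-injective α β eq = p , en

  -- Every bundle and every conflict of a parallel composition lies in one operand, so the
  -- interleaving itself is unconstrained.
  ∥-path : ∀ {ℰ ℱ} (α : List (Event ℰ ⊎ Event ℱ)) →
           Path ℰ (lefts α) → Path ℱ (rights α) → Path (ℰ ∥ ℱ) α
  ∥-path {ℰ} {ℱ} α = go (reverseView α)
    where
    go : ∀ {α} → Reverse α → Path ℰ (lefts α) → Path ℱ (rights α) → Path (ℰ ∥ ℱ) α
    go [] _ _ = []
    go (α ∶ rs ∶ʳ inj₁ e) p q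
      with p′ , en ← ▷⁻ (lefts α) (subst (Path ℰ) (lefts-++ α _) p)
         = go rs p′ (subst (Path ℱ) (trans (rights-++ α _) (++-identityʳ _)) q) ▷ record
      { fresh      = λ e∈ → fresh en (∈-lefts⁺ e∈)
      ; compatible = λ { d∈ (inj₁ c) → compatible en (∈-lefts⁺ d∈) c }
      ; enabled    = λ { z (inˡ b (_ , ⊆z)) → let d , d∈ , xd = enabled en _ b
                                              in inj₁ d , ∈-lefts⁻ α d∈ , ⊆z xd }
      }
    go (α ∶ rs ∶ʳ inj₂ e) p q
      with q′ , en ← ▷⁻ (rights α) (subst (Path ℱ) (rights-++ α _) q)
         = go rs (subst (Path ℰ) (trans (lefts-++ α _) (++-identityʳ _)) p) q′ ▷ record
      { fresh      = λ e∈ → fresh en (∈-rights⁺ e∈)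
      ; compatible = λ { d∈ (inj₂ c) → compatible en (∈-rights⁺ d∈) c }
      ; enabled    = λ { z (inʳ b (_ , ⊆z)) → let d , d∈ , xd = enabled en _ b
                                              in inj₂ d , ∈-rights⁻ α d∈ , ⊆z xd }
      }

  -- Sums

  module _ {ℰ ℱ : IpBES n} where

    +-path-inj₁ : ∀ {α} → Path ℰ α → Path (ℰ + ℱ) (map inj₁ α)
    +-path-inj₁ []               = []
    +-path-inj₁ (_▷_ {α} p en) = snoc-path (+-path-inj₁ p) record
      { fresh      = λ e∈ → case-fresh (∈-map⁻ inj₁ e∈)
      ; compatible = λ d∈ → case-compatible (∈-map⁻ inj₁ d∈)
      ; enabled    = λ { z (inˡ b (_ , ⊆z)) → let d , d∈ , xd = enabled en _ b
                                              in inj₁ d , ∈-map⁺ inj₁ d∈ , ⊆z xd }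
      } (map-∷ʳ inj₁ α)
      where
      case-fresh : ¬ (∃[ d ] d ∈ α × inj₁ _ ≡ inj₁ d)
      case-fresh (_ , d∈ , refl) = fresh en d∈
      case-compatible : ∀ {d′} → ∃[ d ] d ∈ α × d′ ≡ inj₁ d → ¬ +-Conflict ℰ ℱ d′ (inj₁ _)
      case-compatible (_ , d∈ , refl) (operand (inj₁ c)) = compatible en d∈ c

    +-path-inj₂ : ∀ {α} → Path ℱ α → Path (ℰ + ℱ) (map inj₂ α)
    +-path-inj₂ []               = []
    +-path-inj₂ (_▷_ {α} p en) = snoc-path (+-path-inj₂ p) record
      { fresh      = λ e∈ → case-fresh (∈-map⁻ inj₂ e∈)
      ; compatible = λ d∈ → case-compatible (∈-map⁻ inj₂ d∈)
      ; enabled    = λ { z (inʳ b (_ , ⊆z)) → let d , d∈ , xd = enabled en _ b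
                                              in inj₂ d , ∈-map⁺ inj₂ d∈ , ⊆z xd }
      } (map-∷ʳ inj₂ α)
      where
      case-fresh : ¬ (∃[ d ] d ∈ α × inj₂ _ ≡ inj₂ d)
      case-fresh (_ , d∈ , refl) = fresh en d∈
      case-compatible : ∀ {d′} → ∃[ d ] d ∈ α × d′ ≡ inj₂ d → ¬ +-Conflict ℰ ℱ d′ (inj₂ _)
      case-compatible (_ , d∈ , refl) (operand (inj₂ c)) = compatible en d∈ c

    data SumPath : List (Event ℰ ⊎ Event ℱ) → Set₁ where
      inj₁ : ∀ {α} → Path ℰ α → SumPath (map inj₁ α)
      inj₂ : ∀ {α} → Path ℱ α → SumPath (map inj₂ α)

    +-enabled-inj₁ : ∀ {α e} → Enabled (ℰ + ℱ) (map inj₁ α) (inj₁ e) → Enabled ℰ α e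
    +-enabled-inj₁ {α} en = record
      { fresh      = λ e∈ → fresh en (∈-map⁺ inj₁ e∈)
      ; compatible = λ d∈ c → compatible en (∈-map⁺ inj₁ d∈) (operand (inj₁ c))
      ; enabled    = λ x b → cases (enabled en (left x) (inˡ b (id , id)))
      }
      where
      cases : ∀ {x} → ∃[ d ] d ∈ map inj₁ α × left x d → ∃[ d ] d ∈ α × x d
      cases (_ , d∈ , xd) with d , d∈′ , refl ← ∈-map⁻ inj₁ d∈ = d , d∈′ , xd

    +-enabled-inj₂ : ∀ {α e} → Enabled (ℰ + ℱ) (map inj₂ α) (inj₂ e) → Enabled ℱ α e
    +-enabled-inj₂ {α} en = record
      { fresh      = λ e∈ → fresh en (∈-map⁺ inj₂ e∈)
      ; compatible = λ d∈ c → compatible en (∈-map⁺ inj₂ d∈) (operand (inj₂ c))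
      ; enabled    = λ x b → cases (enabled en (right x) (inʳ b (id , id)))
      }
      where
      cases : ∀ {x} → ∃[ d ] d ∈ map inj₂ α × right x d → ∃[ d ] d ∈ α × x d
      cases (_ , d∈ , xd) with d , d∈′ , refl ← ∈-map⁻ inj₂ d∈ = d , d∈′ , xd

    -- A trace cannot change the summand. The event that does so has only events of the other
    -- summand before it, which satisfy none of its bundles, so it is initial; the first event of
    -- the trace is initial as well, and the sum puts the two in conflict.
    +-sound : ∀ {α} → Path (ℰ + ℱ) α → SumPath α
    +-sound []       = inj₁ []
    +-sound (_▷_ {e = e} p en) with +-sound p
    +-sound (_▷_ {e = inj₁ e} p en) | inj₁ {α} q =
      subst SumPath (map-∷ʳ inj₁ α) (inj₁ (q ▷ +-enabled-inj₁ en))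
    +-sound (_▷_ {e = inj₂ f} p en) | inj₂ {α} q =
      subst SumPath (map-∷ʳ inj₂ α) (inj₂ (q ▷ +-enabled-inj₂ en))
    -- The empty trace belongs to both summands, so the first event still chooses freely.
    +-sound (_▷_ {e = inj₂ f} p en) | inj₁ {[]} q = inj₂ ([] ▷ +-enabled-inj₂ en)
    +-sound (_▷_ {e = inj₁ e} p en) | inj₂ {[]} q = inj₁ ([] ▷ +-enabled-inj₁ en)
    +-sound (_▷_ {e = inj₂ f} p en) | inj₁ {d ∷ α} q =
      ⊥-elim (compatible en (here refl) (initial (head-initial q) f-initial))
      where
      f-initial : Initial ℱ f
      f-initial x b with _ , d∈ , xd ← enabled en (right x) (inʳ b (id , id))
        with _ , _ , refl ← ∈-map⁻ inj₁ d∈ = xd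
    +-sound (_▷_ {e = inj₁ e} p en) | inj₂ {d ∷ α} q =
      ⊥-elim (compatible en (here refl) (initial˘ e-initial (head-initial q)))
      where
      e-initial : Initial ℰ e
      e-initial x b with _ , d∈ , xd ← enabled en (left x) (inˡ b (id , id))
        with _ , _ , refl ← ∈-map⁻ inj₂ d∈ = xd

  -- Prefixing by an atomic action

  module _ {a : ℍ̄₁ n} {ℰ : IpBES n} where

    ·-path : ∀ {α} → Path ℰ α → Path (atom a · ℰ) (inj₁ tt ∷ map inj₂ α)
    ·-path [] = [] ▷ record
      { fresh      = λ ()
      ; compatible = λ ()
      ; enabled    = λ { _ (operand (inˡ () _)) }
      }
    ·-path (_▷_ {α} p en) = snoc-path (·-path p) record
      { fresh      = λ { (there e∈) → case-fresh (∈-map⁻ inj₂ e∈) }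
      ; compatible = λ { (there d∈) → case-compatible (∈-map⁻ inj₂ d∈) ; (here refl) () }
      ; enabled    = λ { z (operand (inʳ b (_ , ⊆z))) → let d , d∈ , xd = enabled en _ b
                                                        in inj₂ d , there (∈-map⁺ inj₂ d∈) , ⊆z xd
                       ; z (next (lift (_ , ⊆x)) _ (_ , ⊆z)) → inj₁ tt , here refl , ⊆z (⊆x refl) }
      } (cong (inj₁ tt ∷_) (map-∷ʳ inj₂ α))
      where
      case-fresh : ¬ (∃[ d ] d ∈ α × inj₂ _ ≡ inj₂ d)
      case-fresh (_ , d∈ , refl) = fresh en d∈
      case-compatible : ∀ {d′} → ∃[ d ] d ∈ α × d′ ≡ inj₂ d → ¬ Conflict (atom a) ℰ d′ (inj₂ _)
      case-compatible (_ , d∈ , refl) (inj₂ c) = compatible en d∈ c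

    data PrefixPath : List (⊤ ⊎ Event ℰ) → Set₁ where
      []      : PrefixPath []
      guarded : ∀ {α} → Path ℰ α → PrefixPath (inj₁ tt ∷ map inj₂ α)

    -- Nothing of `ℰ` can come first: a non-initial event waits for its own bundles, an initial one
    -- for the bundle that consists of the prefixed action.
    ·-sound : ∀ {α} → Path (atom a · ℰ) α → PrefixPath α
    ·-sound []       = []
    ·-sound (_▷_ {e = e} p en) with ·-sound p
    ·-sound (_▷_ {e = inj₁ tt} p en) | []          = guarded []
    ·-sound (_▷_ {e = inj₂ e} p en)  | []          = ⊥-elim
      (absurd (enabled en _ (next (lift (id , id)) e-initial (id , id))))
      where
      absurd : ∀ {x : ⊤ ⊎ Event ℰ → Set} → ¬ (∃[ d ] d ∈ [] × x d)
      absurd (_ , () , _)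
      e-initial : Initial ℰ e
      e-initial x b with _ , () , _ ← enabled en (right x) (operand (inʳ b (id , id)))
    ·-sound (_▷_ {e = inj₁ tt} p en) | guarded _   = ⊥-elim (fresh en (here refl))
    ·-sound (_▷_ {e = inj₂ e} p en)  | guarded {α} q =
      subst PrefixPath (cong (inj₁ tt ∷_) (map-∷ʳ inj₂ α)) (guarded (q ▷ record
        { fresh      = λ e∈ → fresh en (there (∈-map⁺ inj₂ e∈))
        ; compatible = λ d∈ c → compatible en (there (∈-map⁺ inj₂ d∈)) (inj₂ c)
        ; enabled    = λ x b → cases (enabled en (right x) (operand (inʳ b (id , id))))
        }))
      where
      cases : ∀ {x} → ∃[ d ] d ∈ inj₁ tt ∷ map inj₂ α × right x d → ∃[ d ] d ∈ α × x d
      cases (_ , here refl , ())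
      cases (_ , there d∈ , xd) with d , d∈′ , refl ← ∈-map⁻ inj₂ d∈ = d , d∈′ , xd

  -- The star of an atomic action

  module _ {a : ℍ̄₁ n} {ℱ : IpBES n} where

    private
      E = *-Event (atom a) ℱ

    iterations : ℕ → List E
    iterations zero    = []
    iterations (suc k) = iterations k ∷ʳ (k , inj₁ tt)

    copyᵉ : ℕ → Event ℱ → E
    copyᵉ k f = k , inj₂ f

    data InRun (k : ℕ) (α : List (Event ℱ)) : E → Set where
      loop : ∀ {i} → i < k → InRun k α (i , inj₁ tt)
      exit : ∀ {f} → f ∈ α → InRun k α (k , inj₂ f)

    ∈-iterations⁺ : ∀ {i k} → i < k → (i , inj₁ tt) ∈ iterations k
    ∈-iterations⁺ {i} {suc k} i<sk with ℕ.m≤n⇒m<n∨m≡n (ℕ.s≤s⁻¹ i<sk)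
    ... | inj₁ i<k  = ∈-++⁺ˡ (∈-iterations⁺ i<k)
    ... | inj₂ refl = ∈-++⁺ʳ (iterations k) (here refl)

    ∈-iterations⁻ : ∀ {d} k {α} → d ∈ iterations k → InRun k α d
    ∈-iterations⁻ (suc k) {α} d∈ with ∈-++⁻ (iterations k) d∈
    ... | inj₂ (here refl) = loop ℕ.≤-refl
    ... | inj₁ d∈′ with ∈-iterations⁻ k {[]} d∈′
    ...   | loop i<k = loop (ℕ.m<n⇒m<1+n i<k)

    run : ℕ → List (Event ℱ) → List E
    run k α = iterations k ++ map (copyᵉ k) α

    ∈-run⁺ : ∀ {d k α} → InRun k α d → d ∈ run k α
    ∈-run⁺         (loop i<k) = ∈-++⁺ˡ (∈-iterations⁺ i<k)
    ∈-run⁺ {k = k} (exit f∈)  = ∈-++⁺ʳ (iterations k) (∈-map⁺ (copyᵉ k) f∈)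

    ∈-run⁻ : ∀ {d} k α → d ∈ run k α → InRun k α d
    ∈-run⁻ k α d∈ with ∈-++⁻ (iterations k) d∈
    ... | inj₁ d∈′ = ∈-iterations⁻ k d∈′
    ... | inj₂ d∈′ with _ , f∈ , refl ← ∈-map⁻ (copyᵉ k) d∈′ = exit f∈

    run-∷ʳ : ∀ k α {f} → run k (α ∷ʳ f) ≡ run k α ∷ʳ copyᵉ k f
    run-∷ʳ k α {f} = trans (cong (iterations k ++_) (map-∷ʳ (copyᵉ k) α))
      (sym (++-assoc (iterations k) (map (copyᵉ k) α) _))

    run-path : ∀ k {α} → Path ℱ α → Path (atom a * ℱ) (run k α)
    run-path zero    [] = []
    run-path (suc k) [] = snoc-path (run-path k []) record
      { fresh      = λ e∈ → case-fresh (∈-run⁻ k [] e∈)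
      ; compatible = λ d∈ → case-compatible (∈-run⁻ k [] d∈)
      ; enabled    = λ { z (operand (inˡ () _) _)
                       ; z (nextˡ {k = k} (lift (_ , ⊆x)) _ (_ , ⊆z)) →
                           (k , inj₁ tt) , ∈-run⁺ {α = []} (loop ℕ.≤-refl) , ⊆z (refl , ⊆x refl) }
      } (trans (++-identityʳ _) (cong (_∷ʳ _) (sym (++-identityʳ _))))
      where
      case-fresh : ¬ InRun k [] (k , inj₁ tt)
      case-fresh (loop k<k) = ℕ.<-irrefl refl k<k
      case-compatible : ∀ {d} → InRun k [] d → ¬ *-Conflict (atom a) ℱ d (k , inj₁ tt)
      case-compatible (loop _) (operand (inj₁ ()))
    run-path k (_▷_ {α} {f} p en) = snoc-path (run-path k p) record
      { fresh      = λ e∈ → case-fresh (∈-run⁻ k α e∈)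
      ; compatible = λ d∈ → case-compatible (∈-run⁻ k α d∈)
      ; enabled    = λ { z (operand (inʳ b (_ , ⊆w)) (_ , ⊆z)) →
                           let d , d∈ , xd = enabled en _ b
                           in copyᵉ k d , ∈-run⁺ (exit d∈) , ⊆z (refl , ⊆w xd)
                       ; z (nextʳ {k = k} (lift (_ , ⊆x)) _ (_ , ⊆z)) →
                           (k , inj₁ tt) , ∈-run⁺ {α = α} (loop ℕ.≤-refl) , ⊆z (refl , ⊆x refl) }
      } (run-∷ʳ k α)
      where
      case-fresh : ¬ InRun k α (k , inj₂ f)
      case-fresh (exit f∈) = fresh en f∈
      case-compatible : ∀ {d} → InRun k α d → ¬ *-Conflict (atom a) ℱ d (k , inj₂ f)
      case-compatible (loop k<k) (initial _ _)      = ℕ.<-irrefl refl k<k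
      case-compatible (exit d∈) (operand (inj₂ c))   = compatible en d∈ c
      case-compatible (exit d∈) (exit k≢k _ _ _ _) = k≢k refl

    -- Copy `suc j` is entered through the bundle consisting of the loop event of copy `j`, and a
    -- run with `k` iterations contains that event only for `j < k`.
    predecessor : ∀ {k α j e} →
      (∃[ d ] d ∈ run k α × copy (atom a) ℱ j (left (tt ≡_)) d) → e ≡ suc j → e ≤ k
    predecessor {k} {α} (_ , d∈ , xd) refl with ∈-run⁻ k α d∈
    predecessor (_ , d∈ , refl , _) refl | loop i<k = i<k

    loop≤ : ∀ {k α j} → Enabled (atom a * ℱ) (run k α) (j , inj₁ tt) → j ≤ k
    loop≤ {j = zero}      en = ℕ.z≤n
    loop≤ {α = α} {suc j} en = predecessor {α = α}
      (enabled en _ (nextˡ (lift (id , id)) (λ { _ (lift ()) }) (id , id))) refl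

    initial≤ : ∀ {k α j f} → Initial ℱ f → Enabled (atom a * ℱ) (run k α) (j , inj₂ f) → j ≤ k
    initial≤ {j = zero}      i en = ℕ.z≤n
    initial≤ {α = α} {suc j} i en = predecessor {α = α}
      (enabled en _ (nextʳ (lift (id , id)) i (id , id))) refl

    -- In a copy other than `k` no event of `ℱ` has occurred, so `f` would have to be initial. Then
    -- its copy has been reached, which leaves `j < k`; but there the loop event has occurred, and
    -- it conflicts with the initial events of its copy.
    enabled-exit : ∀ {k α j f} → Enabled (atom a * ℱ) (run k α) (j , inj₂ f) → j ≡ k
    enabled-exit {k} {α} {j} {f} en with j ℕ.≟ k
    ... | yes j≡k = j≡k
    ... | no  j≢k = ⊥-elim (compatible en (∈-run⁺ {α = α} (loop (ℕ.≤∧≢⇒< (initial≤ {α = α} f-initial en) j≢k)))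
                      (initial (λ { _ (lift ()) }) f-initial))
      where
      f-initial : Initial ℱ f
      f-initial x b with _ , d∈ , xd ← enabled en _ (operand (inʳ b (id , id)) (id , id))
        with ∈-run⁻ k α d∈ | xd
      ... | exit _ | refl , _ = j≢k refl

    data RunPath : List E → Set₁ where
      ran : ∀ k {α} → Path ℱ α → RunPath (run k α)

    -- A further loop event must be that of copy `k`: the earlier ones have been used and the later
    -- ones are out of reach. It also requires that `ℱ` has not begun in copy `k`, since the first
    -- event of `ℱ` there is initial and in conflict with it.
    *-sound : ∀ {α} → Path (atom a * ℱ) α → RunPath α
    *-sound []                   = ran zero []
    *-sound (_▷_ {e = j , e} p en) with *-sound p
    *-sound (_▷_ {e = j , inj₂ f} p en) | ran k {α} q with refl ← enabled-exit {α = α} en =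
      subst RunPath (run-∷ʳ k α) (ran k (q ▷ record
        { fresh      = λ f∈ → fresh en (∈-run⁺ (exit f∈))
        ; compatible = λ d∈ c → compatible en (∈-run⁺ (exit d∈)) (operand (inj₂ c))
        ; enabled    = λ x b → cases (enabled en _ (operand (inʳ b (id , id)) (id , id)))
        }))
      where
      cases : ∀ {x} → ∃[ d ] d ∈ run k α × copy (atom a) ℱ k (right x) d → ∃[ d ] d ∈ α × x d
      cases (_ , d∈ , xd) with ∈-run⁻ k α d∈
      cases (_ , d∈ , _ , xd) | exit f∈ = _ , f∈ , xd
    *-sound (_▷_ {e = j , inj₁ tt} p en) | ran k {α} q
      with ℕ.m≤n⇒m<n∨m≡n (loop≤ {α = α} en)
    ... | inj₁ j<k  = ⊥-elim (fresh en (∈-run⁺ {α = α} (loop j<k)))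
    *-sound (_▷_ {e = j , inj₁ tt} p en) | ran k {[]}    q | inj₂ refl =
      subst RunPath (trans (++-identityʳ _) (cong (_∷ʳ _) (sym (++-identityʳ _)))) (ran (suc k) [])
    *-sound (_▷_ {e = j , inj₁ tt} p en) | ran k {f ∷ α} q | inj₂ refl =
      ⊥-elim (compatible en (∈-run⁺ (exit (here refl))) (initial˘ (λ { _ (lift ()) }) (head-initial q)))

    -- The same runs read from the front, with the number of completed iterations as an index, for
    -- recursions such as `weave` that consume a trace from its head.
    data Run (k : ℕ) : List E → Set₁ where
      exit : ∀ {α} → Path ℱ α → Run k (map (copyᵉ k) α)
      loop : ∀ {α} → Run (suc k) α → Run k ((k , inj₁ tt) ∷ α)

    Run⇒path : ∀ k {α} → Run k α → Path (atom a * ℱ) (iterations k ++ α)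
    Run⇒path k (exit p) = run-path k p
    Run⇒path k (loop p) = subst (Path _) (∷ʳ-++ (iterations k) _ _) (Run⇒path (suc k) p)

    path⇒Run : ∀ {α} → Path (atom a * ℱ) α → Run 0 α
    path⇒Run p with *-sound p
    ... | ran k q = unwind k (exit q)
      where
      unwind : ∀ k {α} → Run k α → Run 0 (iterations k ++ α)
      unwind zero    p = p
      unwind (suc k) p = subst (Run 0) (sym (∷ʳ-++ (iterations k) _ _)) (unwind k (loop p))

  -- Finite sets of traces

  -- Whether a candidate is kept has to be known as data, whereas the reason may stay irrelevant.
  -- This weak form of decision is available even where `IsTrace` has no decision procedure.
  data Certified (ℰ : IpBES n) (α : List (Event ℰ)) : Set₁ where
    certify : .(IsTrace ℰ α) → Certified ℰ α
    refute  : .(¬ IsTrace ℰ α) → Certified ℰ α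

  trace-≡ : ∀ {ℰ : IpBES n} {α β : Trace ℰ} → events α ≡ events β → α ≡ β
  trace-≡ {α = trace _ _} {trace _ _} refl = refl

  finite-⊆ : ∀ {p ℰ} {P : Trace ℰ → Set p} (αs : List (List (Event ℰ))) → All (Certified ℰ) αs →
             (∀ {α} → P α → events α ∈ αs) → Finite {n} P
  finite-⊆ {ℰ = ℰ} αs cs P⊆ =
    collect αs cs , λ {α} Pα → collect-∈ αs cs α (P⊆ Pα)
    where
    collect : ∀ αs → All (Certified ℰ) αs → List (Trace ℰ)
    collect []       []                = []
    collect (α ∷ αs) (certify t ∷ cs) = trace α t ∷ collect αs cs
    collect (α ∷ αs) (refute _ ∷ cs)  = collect αs cs
    collect-∈ : ∀ αs cs α → events α ∈ αs → α ∈ collect αs cs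
    collect-∈ (_ ∷ αs) (certify t ∷ cs) α            (here eq)  = here (trace-≡ eq)
    collect-∈ (_ ∷ αs) (certify t ∷ cs) α            (there α∈) = there (collect-∈ αs cs α α∈)
    collect-∈ (_ ∷ αs) (refute ¬t ∷ cs) (trace _ t) (here refl) = ⊥-elim-irr (¬t t)
    collect-∈ (_ ∷ αs) (refute ¬t ∷ cs) α            (there α∈) = collect-∈ αs cs α α∈

  ⊑ℍ-refl : (a : ℍ̄₁ n) → a ⊑ℍ a
  ⊑ℍ-refl a s μ∈ = μ∈

-- Traces of r ⋆

⋆Event : Set
⋆Event = ℕ × (⊤ ⊎ ⊤)

-- Iteration true k and Iteration false k contain the continuations of a trace of r ⋆ after k
-- iterations, respectively the maximal ones.
data Iteration : Bool → ℕ → List ⋆Event → Set where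
  stop : ∀ {k} → Iteration true k []
  skip : ∀ {o k} → Iteration o k ((k , inj₂ tt) ∷ [])
  loop : ∀ {o k α} → Iteration o (suc k) α → Iteration o k ((k , inj₁ tt) ∷ α)

Iter Complete : ℕ → List ⋆Event → Set
Iter     = Iteration true
Complete = Iteration false

-- Through `recompute`, this recovers the loop part of a trace from its irrelevant proof.
iter? : ∀ k α → Dec (Iter k α)
iter? k []                       = yes stop
iter? k ((j , inj₁ _) ∷ α)       with k ℕ.≟ j
... | yes refl = map′ loop (λ { (loop p) → p }) (iter? (suc k) α)
... | no  k≢j  = no λ { (loop _) → k≢j refl }
iter? k ((j , inj₂ _) ∷ [])      = map′ (λ { refl → skip }) (λ { skip → refl }) (k ℕ.≟ j)
iter? k ((j , inj₂ _) ∷ (_ ∷ _)) = no λ ()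

module _ {n : ℕ} (r : ℍ₁ n) where

  path⇒iter : ∀ {α} → Path (r ⋆) α → Iter 0 α
  path⇒iter p = go (path⇒Run p)
    where
    go : ∀ {k α} → Run {n} {program r} {𝟙} k α → Iter k α
    go (exit p) with atom-sound p
    ... | inj₁ refl = stop
    ... | inj₂ refl = skip
    go (loop p) = loop (go p)

  iter⇒path : ∀ {α} → Iter 0 α → Path (r ⋆) α
  iter⇒path p = Run⇒path 0 (go p)
    where
    go : ∀ {k α} → Iter k α → Run {n} {program r} {𝟙} k α
    go stop     = exit []
    go skip     = exit atom-initial
    go (loop p) = loop (go p)

complete-maximal : ∀ {k α γ} → Complete k α → Iter k (α ++ γ) → γ ≡ []
complete-maximal skip     skip     = refl
complete-maximal (loop p) (loop q) = complete-maximal p q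

-- As long as the 1 has not occurred it can be appended; so the loops in a maximal trace have ended.
extend : ∀ {k α} → Iter k α → Complete k α ⊎ ∃[ d ] Iter k (α ∷ʳ d)
extend {k} stop = inj₂ ((k , inj₂ tt) , skip)
extend skip     = inj₁ skip
extend (loop p) = Sum.map loop (λ (d , q) → d , loop q) (extend p)

-- Merging two loops

-- The flag records whether the first 1 has been dropped.
thin : Bool → ℕ → List ⋆Event → List ⋆Event
thin s     k []                 = []
thin s     k ((_ , inj₁ _) ∷ α) = (k , inj₁ tt) ∷ thin s (suc k) α
thin false k ((_ , inj₂ _) ∷ α) = thin true k α
thin true  k ((_ , inj₂ _) ∷ α) = (k , inj₂ tt) ∷ thin true k α

thin-∷ʳ-true : ∀ k α d → ∃[ m ] thin true k (α ∷ʳ d) ≡ thin true k α ∷ʳ (m , proj₂ d)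
thin-∷ʳ-true k []                 (_ , inj₁ _) = k , refl
thin-∷ʳ-true k []                 (_ , inj₂ _) = k , refl
thin-∷ʳ-true k ((_ , inj₁ _) ∷ α) d =
  let m , eq = thin-∷ʳ-true (suc k) α d in m , cong (_ ∷_) eq
thin-∷ʳ-true k ((_ , inj₂ _) ∷ α) d =
  let m , eq = thin-∷ʳ-true k α d in m , cong (_ ∷_) eq

-- An event is dropped only when it is the first 1, and then the output consists of iterations
-- alone. The last component records this, to exclude a drop at the end of a maximal trace.
thin-∷ʳ : ∀ k α d →
  (∃[ m ] thin false k (α ∷ʳ d) ≡ thin false k α ∷ʳ (m , proj₂ d)) ⊎
  (thin false k (α ∷ʳ d) ≡ thin false k α × proj₂ d ≡ inj₂ tt × ¬ Complete k (thin false k α))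
thin-∷ʳ k []                 (_ , inj₁ _) = inj₁ (k , refl)
thin-∷ʳ k []                 (_ , inj₂ _) = inj₂ (refl , refl , λ ())
thin-∷ʳ k ((_ , inj₁ _) ∷ α) d =
  Sum.map (λ (m , eq) → m , cong (_ ∷_) eq)
          (λ (eq , eq′ , ¬c) → cong (_ ∷_) eq , eq′ , λ { (loop c) → ¬c c })
          (thin-∷ʳ (suc k) α d)
thin-∷ʳ k ((_ , inj₂ _) ∷ α) d = inj₁ (thin-∷ʳ-true k α d)

length-thin-true : ∀ k α → length (thin true k α) ≡ length α
length-thin-true k []                 = refl
length-thin-true k ((_ , inj₁ _) ∷ α) = cong suc (length-thin-true (suc k) α)
length-thin-true k ((_ , inj₂ _) ∷ α) = cong suc (length-thin-true k α)

-- At most one event is lost, which bounds the length of the preimages of a given word.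
length-thin : ∀ k α → length α ≤ suc (length (thin false k α))
length-thin k []                 = ℕ.z≤n
length-thin k ((_ , inj₁ _) ∷ α) = ℕ.s≤s (length-thin (suc k) α)
length-thin k ((_ , inj₂ _) ∷ α) = ℕ.s≤s (ℕ.≤-reflexive (sym (length-thin-true k α)))

merge : ℕ → List (⋆Event ⊎ ⋆Event) → List ⋆Event
merge k α = thin false k (map reduce α)

reduce-rights : ∀ {A : Set} (α : List (A ⊎ A)) → lefts α ≡ [] → map reduce α ≡ rights α
reduce-rights []           eq = refl
reduce-rights (inj₂ _ ∷ α) eq = cong (_ ∷_) (reduce-rights α eq)

reduce-lefts : ∀ {A : Set} (α : List (A ⊎ A)) → rights α ≡ [] → map reduce α ≡ lefts α
reduce-lefts []           eq = refl
reduce-lefts (inj₁ _ ∷ α) eq = cong (_ ∷_) (reduce-lefts α eq)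

skip⁻ : ∀ {o k j α} → Iteration o k ((j , inj₂ tt) ∷ α) → α ≡ [] × k ≡ j
skip⁻ skip = refl , refl

thin-iteration : ∀ {o j} k {α} → Iteration o j α → Iteration o k (thin true k α)
thin-iteration k stop     = stop
thin-iteration k skip     = skip
thin-iteration k (loop p) = loop (thin-iteration (suc k) p)

-- Once one side has reached its 1, all remaining events belong to the other side and only need
-- renumbering. Keeping `o` general serves twice: `true` makes the merged word a trace, `false`
-- makes it maximal.
merge-iteration : ∀ {o i j} k α → Iteration o i (lefts α) → Iteration o j (rights α) →
                  Iteration o k (merge k α)
merge-iteration k []                     stop     stop     = stop
merge-iteration k (inj₁ (_ , inj₁ _) ∷ α) (loop p) q        = loop (merge-iteration (suc k) α p q)
merge-iteration k (inj₂ (_ , inj₁ _) ∷ α) p        (loop q) = loop (merge-iteration (suc k) α p q)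
merge-iteration {o} k (inj₁ (_ , inj₂ _) ∷ α) p    q
  with eq , _ ← skip⁻ p =
  subst (Iteration o k ∘ thin true k) (sym (reduce-rights α eq)) (thin-iteration k q)
merge-iteration {o} k (inj₂ (_ , inj₂ _) ∷ α) p    q
  with eq , _ ← skip⁻ q =
  subst (Iteration o k ∘ thin true k) (sym (reduce-lefts α eq)) (thin-iteration k p)

-- The counters `i` and `j` determine the copy number of the next event on either side, which leaves
-- four choices per position. Lists that continue a side after its 1 are included too; `certified`
-- removes them.
shuffles : ℕ → ℕ → ℕ → List (List (⋆Event ⊎ ⋆Event))
shuffles zero    i j = [] ∷ []
shuffles (suc n) i j = [] ∷
  map (inj₁ (i , inj₁ tt) ∷_) (shuffles n (suc i) j) ++
  map (inj₂ (j , inj₁ tt) ∷_) (shuffles n i (suc j)) ++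
  map (inj₁ (i , inj₂ tt) ∷_) (shuffles n i j) ++
  map (inj₂ (j , inj₂ tt) ∷_) (shuffles n i j)

∈-shuffles : ∀ {i j} n α → Iter i (lefts α) → Iter j (rights α) → length α ≤ n → α ∈ shuffles n i j
∈-shuffles zero    []      p q α≤n = here refl
∈-shuffles (suc n) []      p q α≤n = here refl
∈-shuffles {i} {j} (suc n) (inj₁ (_ , inj₁ _) ∷ α) (loop p) q (ℕ.s≤s α≤n) =
  there (∈-++⁺ˡ (∈-map⁺ (inj₁ (i , inj₁ tt) ∷_) (∈-shuffles n α p q α≤n)))
∈-shuffles {i} {j} (suc n) (inj₂ (_ , inj₁ _) ∷ α) p (loop q) (ℕ.s≤s α≤n) =
  there (∈-++⁺ʳ (map (inj₁ (i , inj₁ tt) ∷_) (shuffles n (suc i) j))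
        (∈-++⁺ˡ (∈-map⁺ (inj₂ (j , inj₁ tt) ∷_) (∈-shuffles n α p q α≤n))))
∈-shuffles {i} {j} (suc n) (inj₁ (_ , inj₂ _) ∷ α) p q (ℕ.s≤s α≤n) with eq , refl ← skip⁻ p =
  there (∈-++⁺ʳ (map (inj₁ (i , inj₁ tt) ∷_) (shuffles n (suc i) j))
        (∈-++⁺ʳ (map (inj₂ (j , inj₁ tt) ∷_) (shuffles n i (suc j)))
        (∈-++⁺ˡ (∈-map⁺ (inj₁ (i , inj₂ tt) ∷_)
          (∈-shuffles n α (subst (Iter i) (sym eq) stop) q α≤n)))))
∈-shuffles {i} {j} (suc n) (inj₂ (_ , inj₂ _) ∷ α) p q (ℕ.s≤s α≤n) with eq , refl ← skip⁻ q =
  there (∈-++⁺ʳ (map (inj₁ (i , inj₁ tt) ∷_) (shuffles n (suc i) j))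
        (∈-++⁺ʳ (map (inj₂ (j , inj₁ tt) ∷_) (shuffles n i (suc j)))
        (∈-++⁺ʳ (map (inj₁ (i , inj₂ tt) ∷_) (shuffles n i j))
        (∈-map⁺ (inj₂ (j , inj₂ tt) ∷_)
          (∈-shuffles n α p (subst (Iter j) (sym eq) stop) α≤n)))))

module _ {n : ℕ} (r : ℍ₁ n) where

  Shuffle : List (⋆Event ⊎ ⋆Event) → Set
  Shuffle α = Iter 0 (lefts α) × Iter 0 (rights α)

  trace⇒shuffle : ∀ {α} → IsTrace (r ⋆ ∥ r ⋆) α → Shuffle α
  trace⇒shuffle t = path⇒iter r (∥-lefts (trace⇒path t)) , path⇒iter r (∥-rights (trace⇒path t))

  shuffle⇒trace : ∀ α → Shuffle α → IsTrace (r ⋆ ∥ r ⋆) α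
  shuffle⇒trace α (p , q) = path⇒trace (∥-path α (iter⇒path r p) (iter⇒path r q))

  certified : ∀ α → Certified (r ⋆ ∥ r ⋆) α
  certified α with iter? 0 (lefts α) | iter? 0 (rights α)
  ... | yes p | yes q = certify (shuffle⇒trace α (p , q))
  ... | no ¬p | _     = refute (¬p ∘ proj₁ ∘ trace⇒shuffle)
  ... | yes _ | no ¬q = refute (¬q ∘ proj₂ ∘ trace⇒shuffle)

  shuffle : (α : Trace (r ⋆ ∥ r ⋆)) → Shuffle (events α)
  shuffle (trace α t) =
    recompute (iter? 0 (lefts α)) (proj₁ (trace⇒shuffle t)) ,
    recompute (iter? 0 (rights α)) (proj₂ (trace⇒shuffle t))

  iter : (α : Trace (r ⋆)) → Iter 0 (events α)
  iter (trace α t) = recompute (iter? 0 α) (path⇒iter r (trace⇒path t))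

  maximal⇒complete : ∀ α → Maximal α → Complete 0 (lefts (events α)) × Complete 0 (rights (events α))
  maximal⇒complete α max with p , q ← shuffle α with extend p | extend q
  ... | inj₁ c | inj₁ d = c , d
  ... | inj₂ (d , p′) | _ with () ← max (trace _ (shuffle⇒trace (events α ∷ʳ inj₁ d)
          (subst (Iter 0) (sym (lefts-++ (events α) _)) p′ ,
           subst (Iter 0) (sym (trans (rights-++ (events α) _) (++-identityʳ _))) q))) _ refl
  ... | inj₁ _ | inj₂ (d , q′) with () ← max (trace _ (shuffle⇒trace (events α ∷ʳ inj₂ d)
          (subst (Iter 0) (sym (trans (lefts-++ (events α) _) (++-identityʳ _))) p ,
           subst (Iter 0) (sym (rights-++ (events α) _)) q′))) _ refl

  merged : Trace (r ⋆ ∥ r ⋆) → Trace (r ⋆)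
  merged α = let p , q = shuffle α in
    trace (merge 0 (events α)) (path⇒trace (iter⇒path r (merge-iteration 0 (events α) p q)))

  label-reduce : ∀ e {d} → proj₂ (reduce e) ≡ d →
                 IpBES.label (r ⋆ ∥ r ⋆) e ⊑ℍ Label (atom (program r)) 𝟙 d
  label-reduce (inj₁ (_ , d)) refl = ⊑ℍ-refl (Label (atom (program r)) 𝟙 d)
  label-reduce (inj₂ (_ , d)) refl = ⊑ℍ-refl (Label (atom (program r)) 𝟙 d)

  merge-∷ʳ : ∀ α e →
    (∃[ e′ ] merge 0 (α ∷ʳ e) ≡ merge 0 α ∷ʳ e′ ×
             IpBES.label (r ⋆ ∥ r ⋆) e ⊑ℍ IpBES.label (r ⋆) e′) ⊎
    (merge 0 (α ∷ʳ e) ≡ merge 0 α × IpBES.label (r ⋆ ∥ r ⋆) e ⊑ℍ program δ ×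
     ¬ Complete 0 (merge 0 α))
  merge-∷ʳ α e rewrite map-∷ʳ reduce α {e} with thin-∷ʳ 0 (map reduce α) (reduce e)
  ... | inj₁ (m , eq)       = inj₁ (_ , eq , label-reduce e refl)
  ... | inj₂ (eq , ≡1 , ¬c) = inj₂ (eq , label-reduce e ≡1 , ¬c)

  ⋆∥⋆⊑⋆ : r ⋆ ∥ r ⋆ ⊑sim r ⋆
  ⋆∥⋆⊑⋆ = merged , record
    { empty   = refl
    ; finite  = λ β → finite-⊆ (shuffles (size β) 0 0) (All.tabulate λ {α} _ → certified α)
                  λ { {α} refl → let p , q = shuffle α in
                      ∈-shuffles (size (merged α)) (events α) p q (bound (events α)) }
    ; step    = step
    ; stepMax = stepMax
    }
    where
    size : Trace (r ⋆) → ℕ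
    size β = suc (length (events β))
    bound : ∀ α → length α ≤ suc (length (merge 0 α))
    bound α = subst (_≤ suc (length (merge 0 α))) (length-map reduce α) (length-thin 0 (map reduce α))
    step : ∀ α e αe → events αe ≡ events α ∷ʳ e → _
    step α e αe refl with merge-∷ʳ (events α) e
    ... | inj₁ (e′ , eq , ⊑) = inj₂ (e′ , ⊑ , eq)
    ... | inj₂ (eq , ⊑ , _)  = inj₁ (trace-≡ eq , ⊑)
    stepMax : ∀ α e αe → events αe ≡ events α ∷ʳ e → Maximal αe → _
    stepMax α e αe refl max with merge-∷ʳ (events α) e | maximal⇒complete αe max
    ... | inj₁ (e′ , eq , ⊑) | p , q = (e′ , eq , ⊑) , inj₁ λ β γ β≡ →
          complete-maximal (merge-iteration 0 (events αe) p q) (subst (Iter 0) β≡ (iter β))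
    -- Two complete loops merge into a complete one, but the word before a dropped 1 is not
    -- complete.
    ... | inj₂ (eq , _ , ¬c) | p , q =
          ⊥-elim (¬c (subst (Complete 0) eq (merge-iteration 0 (events αe) p q)))

-- Inserting a loop behind the first event

module _ {A B C D : Set} (f : A → C) (g : B → D) where

  lefts-map : ∀ α → lefts (map (Sum.map f g) α) ≡ map f (lefts α)
  lefts-map []           = refl
  lefts-map (inj₁ _ ∷ α) = cong (_ ∷_) (lefts-map α)
  lefts-map (inj₂ _ ∷ α) = lefts-map α

  rights-map : ∀ α → rights (map (Sum.map f g) α) ≡ map g (rights α)
  rights-map []           = refl
  rights-map (inj₁ _ ∷ α) = rights-map α
  rights-map (inj₂ _ ∷ α) = cong (_ ∷_) (rights-map α)

-- Pulls an interleaving of `r ⋆` with a composite structure back to one with the operand in which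
-- the trace runs.
rights-map⁻ : ∀ {A B C : Set} (g : B → C) (α : List (A ⊎ C)) {β} →
              rights α ≡ map g β → ∃[ γ ] α ≡ map (Sum.map₂ g) γ × rights γ ≡ β
rights-map⁻ g []           {[]}    eq = [] , refl , refl
rights-map⁻ g (inj₁ a ∷ α)         eq =
  let γ , eq₁ , eq₂ = rights-map⁻ g α eq in inj₁ a ∷ γ , cong (_ ∷_) eq₁ , eq₂
rights-map⁻ g (inj₂ c ∷ α) {b ∷ β} eq =
  let eq₀ , eq′ = ∷-injective eq
      γ , eq₁ , eq₂ = rights-map⁻ g α eq′
  in inj₂ b ∷ γ , cong₂ _∷_ (cong inj₂ eq₀) eq₁ , cong (b ∷_) eq₂

lefts-map₂ : ∀ {A B C : Set} (g : B → C) (α : List (A ⊎ B)) → lefts (map (Sum.map₂ g) α) ≡ lefts α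
lefts-map₂ g α = trans (lefts-map id g α) (map-id (lefts α))

module _ {n : ℕ} where

  module _ {G T : IpBES n} (embed : Event G → Event T) (insert : Event G → ⋆Event → Event T) where

    place : Event G → ⋆Event ⊎ Event G → Event T
    place y = [ insert y , embed ]′

    data Inserted : List (Event T) → Set₁ where
      []      : Inserted []
      guarded : ∀ y α → Iter 0 (lefts α) → Path G (y ∷ rights α) → Inserted (embed y ∷ map (place y) α)

  -- T arises from G by running r ⋆ in parallel with whatever follows the first event; a sum has
  -- one copy of r ⋆ for each summand, so insert also depends on the first event.
  record Insertion (r : ℍ₁ n) (G T : IpBES n) : Set₁ where
    field
      embed          : Event G → Event T
      insert         : Event G → ⋆Event → Event T
      extract        : Event T → ⋆Event ⊎ Event G
      extract-embed  : ∀ y → extract (embed y) ≡ inj₂ y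
      extract-insert : ∀ y x → extract (insert y x) ≡ inj₁ x
      label-embed    : ∀ y → IpBES.label G y ⊑ℍ IpBES.label T (embed y)
      label-insert   : ∀ y x → IpBES.label (r ⋆) x ⊑ℍ IpBES.label T (insert y x)
      start          : ∃[ y ] Path G (y ∷ [])
      sound          : ∀ {β} → Path T β → Inserted {G} {T} embed insert β
      complete       : ∀ y α → Iter 0 (lefts α) → Path G (y ∷ rights α) →
                       Path T (embed y ∷ map (place {G} {T} embed insert y) α)

  atom-insertion : ∀ r a → Insertion r (atom a) (atom a · r ⋆)
  atom-insertion r a = record
    { embed          = embed
    ; insert         = insert
    ; extract        = [ inj₂ , inj₁ ]′
    ; extract-embed  = λ _ → refl
    ; extract-insert = λ _ _ → refl
    ; label-embed    = λ _ → ⊑ℍ-refl a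
    ; label-insert   = λ _ x → ⊑ℍ-refl (IpBES.label (r ⋆) x)
    ; start          = tt , atom-initial
    ; sound          = sound
    ; complete       = complete
    }
    where
    embed : ⊤ → ⊤ ⊎ ⋆Event
    embed = inj₁
    insert : ⊤ → ⋆Event → ⊤ ⊎ ⋆Event
    insert _ = inj₂
    sound : ∀ {β} → Path (atom a · r ⋆) β → Inserted {atom a} {atom a · r ⋆} embed insert β
    sound p with ·-sound p
    ... | []              = []
    ... | guarded {α} q = subst (λ β → Inserted {atom a} {atom a · r ⋆} embed insert (inj₁ tt ∷ β))
      (sym (map-∘ α)) (guarded tt (map inj₁ α)
        (subst (Iter 0) (sym (mapMaybeIsInj₁∘mapInj₁ α)) (path⇒iter r q))
        (subst (Path (atom a) ∘ (tt ∷_)) (sym (mapMaybeIsInj₂∘mapInj₁ α)) atom-initial))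
    complete : ∀ y α → Iter 0 (lefts α) → Path (atom a) (y ∷ rights α) →
               Path (atom a · r ⋆) (embed y ∷ map (place {atom a} {atom a · r ⋆} embed insert y) α)
    complete tt α p q with atom-sound q
    ... | inj₂ eq = subst (Path (atom a · r ⋆) ∘ (inj₁ tt ∷_)) (place-lefts α (∷-injectiveʳ eq))
                      (·-path (iter⇒path r p))
      where
      place-lefts : ∀ α → rights α ≡ [] →
                    map inj₂ (lefts α) ≡ map (place {atom a} {atom a · r ⋆} embed insert tt) α
      place-lefts []           _  = refl
      place-lefts (inj₁ _ ∷ α) eq = cong (_ ∷_) (place-lefts α eq)

  ·-insertion : ∀ r a ℰ → Insertion r (atom a · ℰ) (atom a · (r ⋆ ∥ ℰ))
  ·-insertion r a ℰ = record
    { embed          = embed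
    ; insert         = insert
    ; extract        = [ (λ x → inj₂ (inj₁ x)) , Sum.map₂ inj₂ ]′
    ; extract-embed  = λ { (inj₁ _) → refl ; (inj₂ _) → refl }
    ; extract-insert = λ _ _ → refl
    ; label-embed    = λ { (inj₁ _) → ⊑ℍ-refl a ; (inj₂ e) → ⊑ℍ-refl (IpBES.label ℰ e) }
    ; label-insert   = λ _ x → ⊑ℍ-refl (IpBES.label (r ⋆) x)
    ; start          = inj₁ tt , ·-path []
    ; sound          = λ p → sound (·-sound p)
    ; complete       = λ y α p q → complete p (·-sound q) refl
    }
    where
    G = atom a · ℰ
    T = atom a · (r ⋆ ∥ ℰ)
    embed : Event G → Event T
    embed = Sum.map₂ inj₂
    insert : Event G → ⋆Event → Event T
    insert _ x = inj₂ (inj₁ x)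
    place-inj₁ : ∀ (α : List (⋆Event ⊎ Event ℰ)) →
      map (place {G} {T} embed insert (inj₁ tt)) (map (Sum.map₂ inj₂) α) ≡ map inj₂ α
    place-inj₁ α = trans (sym (map-∘ α)) (map-cong (λ { (inj₁ _) → refl ; (inj₂ _) → refl }) α)
    sound : ∀ {β} → PrefixPath {_} {a} {r ⋆ ∥ ℰ} β → Inserted {G} {T} embed insert β
    sound []              = []
    sound (guarded {α} q) = subst (Inserted {G} {T} embed insert ∘ (inj₁ tt ∷_)) (place-inj₁ α)
      (guarded (inj₁ tt) (map (Sum.map₂ inj₂) α)
        (subst (Iter 0) (sym (lefts-map₂ inj₂ α)) (path⇒iter r (∥-lefts q)))
        (subst (Path G ∘ (inj₁ tt ∷_)) (sym (rights-map id inj₂ α)) (·-path (∥-rights q))))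
    complete : ∀ {y α β} → Iter 0 (lefts α) → PrefixPath {_} {a} {ℰ} β → β ≡ y ∷ rights α →
               Path T (embed y ∷ map (place {G} {T} embed insert y) α)
    complete {α = α} p (guarded q) eq =
      lifted (∷-injectiveˡ eq) p q (rights-map⁻ inj₂ α (sym (∷-injectiveʳ eq)))
      where
      lifted : ∀ {y α β} → inj₁ tt ≡ y → Iter 0 (lefts α) → Path ℰ β →
               (∃[ γ ] α ≡ map (Sum.map₂ inj₂) γ × rights γ ≡ β) →
               Path T (embed y ∷ map (place {G} {T} embed insert y) α)
      lifted refl p q (γ , refl , refl) =
        subst (Path T ∘ (inj₁ tt ∷_)) (sym (place-inj₁ γ))
          (·-path (∥-path γ (iter⇒path r (subst (Iter 0) (lefts-map₂ inj₂ γ) p)) q))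

  module _ {r : ℍ₁ n} {G₁ G₂ T₁ T₂ : IpBES n}
           (ι₁ : Insertion r G₁ T₁) (ι₂ : Insertion r G₂ T₂) where
    private
      module ι₁ = Insertion ι₁
      module ι₂ = Insertion ι₂
      G = G₁ + G₂
      T = T₁ + T₂
      embed : Event G → Event T
      embed = Sum.map ι₁.embed ι₂.embed
      insert : Event G → ⋆Event → Event T
      insert (inj₁ y) = inj₁ ∘ ι₁.insert y
      insert (inj₂ y) = inj₂ ∘ ι₂.insert y
      place₁ : ∀ y α → map (place {G} {T} embed insert (inj₁ y)) (map (Sum.map₂ inj₁) α) ≡
                       map inj₁ (map (place {G₁} {T₁} ι₁.embed ι₁.insert y) α)
      place₁ y α = trans (sym (map-∘ α)) (trans
        (map-cong (λ { (inj₁ _) → refl ; (inj₂ _) → refl }) α) (map-∘ α))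
      place₂ : ∀ y α → map (place {G} {T} embed insert (inj₂ y)) (map (Sum.map₂ inj₂) α) ≡
                       map inj₂ (map (place {G₂} {T₂} ι₂.embed ι₂.insert y) α)
      place₂ y α = trans (sym (map-∘ α)) (trans
        (map-cong (λ { (inj₁ _) → refl ; (inj₂ _) → refl }) α) (map-∘ α))
      sound₁ : ∀ {β} → Inserted {G₁} {T₁} ι₁.embed ι₁.insert β →
               Inserted {G} {T} embed insert (map inj₁ β)
      sound₁ []                = []
      sound₁ (guarded y α p q) =
        subst (Inserted {G} {T} embed insert ∘ (inj₁ (ι₁.embed y) ∷_)) (place₁ y α)
          (guarded (inj₁ y) (map (Sum.map₂ inj₁) α)
            (subst (Iter 0) (sym (lefts-map₂ inj₁ α)) p)
            (subst (Path G ∘ (inj₁ y ∷_)) (sym (rights-map id inj₁ α)) (+-path-inj₁ q)))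
      sound₂ : ∀ {β} → Inserted {G₂} {T₂} ι₂.embed ι₂.insert β →
               Inserted {G} {T} embed insert (map inj₂ β)
      sound₂ []                = []
      sound₂ (guarded y α p q) =
        subst (Inserted {G} {T} embed insert ∘ (inj₂ (ι₂.embed y) ∷_)) (place₂ y α)
          (guarded (inj₂ y) (map (Sum.map₂ inj₂) α)
            (subst (Iter 0) (sym (lefts-map₂ inj₂ α)) p)
            (subst (Path G ∘ (inj₂ y ∷_)) (sym (rights-map id inj₂ α)) (+-path-inj₂ q)))
      sound : ∀ {β} → SumPath {_} {T₁} {T₂} β → Inserted {G} {T} embed insert β
      sound (inj₁ q) = sound₁ (ι₁.sound q)
      sound (inj₂ q) = sound₂ (ι₂.sound q)
      complete₁ : ∀ {y₁ y α β} → inj₁ y₁ ≡ y → Iter 0 (lefts α) → Path G₁ (y₁ ∷ β) →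
                  (∃[ γ ] α ≡ map (Sum.map₂ inj₁) γ × rights γ ≡ β) →
                  Path T (embed y ∷ map (place {G} {T} embed insert y) α)
      complete₁ {y₁} refl p q (γ , refl , refl) =
        subst (Path T ∘ (inj₁ (ι₁.embed y₁) ∷_)) (sym (place₁ y₁ γ))
          (+-path-inj₁ (ι₁.complete y₁ γ (subst (Iter 0) (lefts-map₂ inj₁ γ) p) q))
      complete₂ : ∀ {y₂ y α β} → inj₂ y₂ ≡ y → Iter 0 (lefts α) → Path G₂ (y₂ ∷ β) →
                  (∃[ γ ] α ≡ map (Sum.map₂ inj₂) γ × rights γ ≡ β) →
                  Path T (embed y ∷ map (place {G} {T} embed insert y) α)
      complete₂ {y₂} refl p q (γ , refl , refl) =
        subst (Path T ∘ (inj₂ (ι₂.embed y₂) ∷_)) (sym (place₂ y₂ γ))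
          (+-path-inj₂ (ι₂.complete y₂ γ (subst (Iter 0) (lefts-map₂ inj₂ γ) p) q))
      complete : ∀ {y α β} → Iter 0 (lefts α) → SumPath {_} {G₁} {G₂} β → β ≡ y ∷ rights α →
                 Path T (embed y ∷ map (place {G} {T} embed insert y) α)
      complete {α = α} p (inj₁ {_ ∷ _} q) eq =
        complete₁ (∷-injectiveˡ eq) p q (rights-map⁻ inj₁ α (sym (∷-injectiveʳ eq)))
      complete {α = α} p (inj₂ {_ ∷ _} q) eq =
        complete₂ (∷-injectiveˡ eq) p q (rights-map⁻ inj₂ α (sym (∷-injectiveʳ eq)))

    +-insertion : Insertion r G T
    +-insertion = record
      { embed          = embed
      ; insert         = insert
      ; extract        = [ Sum.map₂ inj₁ ∘ ι₁.extract , Sum.map₂ inj₂ ∘ ι₂.extract ]′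
      ; extract-embed  = λ { (inj₁ y) → cong (Sum.map₂ inj₁) (ι₁.extract-embed y)
                           ; (inj₂ y) → cong (Sum.map₂ inj₂) (ι₂.extract-embed y) }
      ; extract-insert = λ { (inj₁ y) x → cong (Sum.map₂ inj₁) (ι₁.extract-insert y x)
                           ; (inj₂ y) x → cong (Sum.map₂ inj₂) (ι₂.extract-insert y x) }
      ; label-embed    = λ { (inj₁ y) → ι₁.label-embed y ; (inj₂ y) → ι₂.label-embed y }
      ; label-insert   = λ { (inj₁ y) → ι₁.label-insert y ; (inj₂ y) → ι₂.label-insert y }
      ; start          = let y , p = ι₁.start in inj₁ y , +-path-inj₁ p
      ; sound          = λ p → sound (+-sound p)
      ; complete       = λ y α p q → complete p (+-sound q) refl
      }

-- The inner loop in copy `k` counts from 0 again, so the `k` outer iterations are subtracted from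
-- its copy numbers.
lower raise : ℕ → ⋆Event → ⋆Event
lower k (j , d) = j ℕ.∸ k , d
raise k (j , d) = k ℕ.+ j , d

iter-lower : ∀ {k j} i {α} → Iter j α → j ≡ k ℕ.+ i → Iter i (map (lower k) α)
iter-lower     i stop     _    = stop
iter-lower {k} i skip     refl rewrite ℕ.m+n∸m≡n k i = skip
iter-lower {k} i (loop p) refl with q ← iter-lower {k} (suc i) p (sym (ℕ.+-suc k i))
  rewrite ℕ.m+n∸m≡n k i = loop q

iter-raise : ∀ {i} k {α} → Iter i α → Iter (k ℕ.+ i) (map (raise k) α)
iter-raise     k stop             = stop
iter-raise     k skip             = skip
iter-raise {i} k {_ ∷ α} (loop p) =
  loop (subst (λ j → Iter j (map (raise k) α)) (ℕ.+-suc k i) (iter-raise k p))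

-- Weaving a parallel loop into a star

module _ {n : ℕ} {r : ℍ₁ n} {G T : IpBES n} (ι : Insertion r G T) where

  open Insertion ι

  private
    R = atom (program r)
    S = r ⋆ ∥ G
    Source = List (⋆Event ⊎ Event G)
    Target = List (*-Event R T)

    place′ : Event G → ⋆Event ⊎ Event G → Event T
    place′ = place {G = G} {T} embed insert

  shift unshift : ℕ → ⋆Event ⊎ Event G → ⋆Event ⊎ Event G
  shift   k = Sum.map₁ (lower k)
  unshift k = Sum.map₁ (raise k)

  weave : ℕ → Source → Target
  weave k []                       = []
  weave k (inj₁ (_ , inj₁ _) ∷ α) = (k , inj₁ tt) ∷ weave (suc k) α
  -- No iteration can follow this 1, and the star has no 1 to offer before the first event of `T`.
  weave k (inj₁ (_ , inj₂ _) ∷ α) = weave k α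
  weave k (inj₂ y ∷ α)            = map (λ e → k , inj₂ e) (embed y ∷ map (place′ y ∘ shift k) α)

  -- A target event determines its source event without the context: its copy number is the number
  -- of outer iterations that `shift` subtracted.
  unweaveᵉ : *-Event R T → ⋆Event ⊎ Event G
  unweaveᵉ (k , inj₁ _) = inj₁ (k , inj₁ tt)
  unweaveᵉ (k , inj₂ e) = unshift k (extract e)

  unweave : Target → Source
  unweave = map unweaveᵉ

  extract-place : ∀ y s → extract (place′ y s) ≡ s
  extract-place y (inj₁ x)  = extract-insert y x
  extract-place y (inj₂ y′) = extract-embed y′

  -- Truncated subtraction is undone by addition because the remaining loop events are numbered from
  -- `j` on, and `k ≤ j`.
  unshift-shift : ∀ {k j} α → Iter j (lefts α) → k ≤ j → map (unshift k ∘ shift k) α ≡ α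
  unshift-shift []                       p        k≤j = refl
  unshift-shift (inj₁ (_ , inj₁ _) ∷ α) (loop p) k≤j =
    cong₂ _∷_ (cong (λ j → inj₁ (j , _)) (ℕ.m+[n∸m]≡n k≤j)) (unshift-shift α p (ℕ.m≤n⇒m≤1+n k≤j))
  unshift-shift {k} {j} (inj₁ (_ , inj₂ _) ∷ α) p k≤j with eq , refl ← skip⁻ p =
    cong₂ _∷_ (cong (λ j → inj₁ (j , _)) (ℕ.m+[n∸m]≡n k≤j))
              (unshift-shift α (subst (Iter j) (sym eq) stop) k≤j)
  unshift-shift (inj₂ _ ∷ α)             p        k≤j = cong (_ ∷_) (unshift-shift α p k≤j)

  unweave-guarded : ∀ k y α → Iter k (lefts α) → unweave (weave k (inj₂ y ∷ α)) ≡ inj₂ y ∷ α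
  unweave-guarded k y α p = cong₂ _∷_
    (cong (unshift k) (extract-embed y))
    (begin
      unweave (map (λ e → k , inj₂ e) (map (place′ y ∘ shift k) α)) ≡⟨ map-∘ _ ⟨
      map (unshift k ∘ extract) (map (place′ y ∘ shift k) α)        ≡⟨ map-∘ α ⟨
      map (unshift k ∘ extract ∘ place′ y ∘ shift k) α
        ≡⟨ map-cong (λ s → cong (unshift k) (extract-place y (shift k s))) α ⟩
      map (unshift k ∘ shift k) α                                   ≡⟨ unshift-shift α p ℕ.≤-refl ⟩
      α                                                             ∎)
    where open ≡-Reasoning

  weave-run : ∀ {k} α → Iter k (lefts α) → Path G (rights α) → Run {a = program r} {T} k (weave k α)
  weave-run []                       p        q = exit []
  weave-run (inj₁ (_ , inj₁ _) ∷ α) (loop p) q = loop (weave-run α p q)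
  weave-run {k} (inj₁ (_ , inj₂ _) ∷ α) p     q with eq , _ ← skip⁻ p =
    weave-run α (subst (Iter k) (sym eq) stop) q
  weave-run {k} (inj₂ y ∷ α)         p        q =
    exit (subst (Path T ∘ (embed y ∷_)) (sym (map-∘ α)) (complete y (map (shift k) α)
      (subst (Iter 0) (sym (lefts-map _ id α)) (iter-lower 0 p (sym (ℕ.+-identityʳ k))))
      (subst (Path G ∘ (y ∷_)) (sym (trans (rights-map _ id α) (map-id (rights α)))) q)))

  unweave-run : ∀ {k β} → Run {a = program r} {T} k β →
                Iter k (lefts (unweave β)) × Path G (rights (unweave β))
  unweave-run (loop p) = let q , q′ = unweave-run p in loop q , q′
  unweave-run {k} (exit p) = inserted (sound p)
    where
    inserted : ∀ {α} → Inserted {G = G} {T} embed insert α →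
               let α′ = unweave (map (λ e → k , inj₂ e) α) in Iter k (lefts α′) × Path G (rights α′)
    inserted []                = stop , []
    inserted (guarded y α p q) = subst (λ β → Iter k (lefts β) × Path G (rights β)) (sym eq)
      ( subst (Iter k) (sym (lefts-map _ id α))
          (subst (λ j → Iter j (map (raise k) (lefts α))) (ℕ.+-identityʳ k) (iter-raise k p))
      , subst (Path G ∘ (y ∷_)) (sym (trans (rights-map _ id α) (map-id (rights α)))) q)
      where
      eq : unweave (map (λ e → k , inj₂ e) (embed y ∷ map (place′ y) α)) ≡ inj₂ y ∷ map (unshift k) α
      eq = cong₂ _∷_ (cong (unshift k) (extract-embed y))
        (trans (sym (map-∘ _)) (trans (sym (map-∘ α))
          (map-cong (λ s → cong (unshift k) (extract-place y s)) α)))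

  -- The condition on `rights` in the second alternative is what rules this alternative out at the
  -- end of a maximal trace.
  Grows : Source → ⋆Event ⊎ Event G → Target → Target → Set
  Grows α e β β′ =
    (∃[ e′ ] β′ ≡ β ∷ʳ e′ × IpBES.label S e ⊑ℍ IpBES.label (R * T) e′) ⊎
    (β′ ≡ β × IpBES.label S e ⊑ℍ program δ × rights (α ∷ʳ e) ≡ [])

  weave-∷ʳ : ∀ k α e → Grows α e (weave k α) (weave k (α ∷ʳ e))
  weave-∷ʳ k [] (inj₁ (_ , inj₁ _)) = inj₁ (_ , refl , ⊑ℍ-refl (program r))
  weave-∷ʳ k [] (inj₁ (_ , inj₂ _)) = inj₂ (refl , ⊑ℍ-refl (program δ) , refl)
  weave-∷ʳ k [] (inj₂ y)            = inj₁ (_ , refl , label-embed y)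
  weave-∷ʳ k (inj₁ (_ , inj₁ _) ∷ α) e =
    Sum.map (λ (e′ , eq , ⊑) → e′ , cong (_ ∷_) eq , ⊑)
            (λ (eq , ⊑ , eq′) → cong (_ ∷_) eq , ⊑ , eq′) (weave-∷ʳ (suc k) α e)
  weave-∷ʳ k (inj₁ (_ , inj₂ _) ∷ α) e = weave-∷ʳ k α e
  weave-∷ʳ k (inj₂ y ∷ α) e = inj₁
    ( (k , inj₂ (place′ y (shift k e)))
    , trans (cong (map (λ e → k , inj₂ e) ∘ (embed y ∷_)) (map-∷ʳ _ α)) (map-∷ʳ _ (embed y ∷ _))
    , label-place e )
    where
    label-place : ∀ e → IpBES.label S e ⊑ℍ IpBES.label T (place′ y (shift k e))
    label-place (inj₁ (j , d)) = label-insert y (j ℕ.∸ k , d)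
    label-place (inj₂ y′)      = label-embed y′

  -- Postponing the 1 that weave drops, if any, to the end of α makes weave emit it.
  record Postponed (k : ℕ) (α : Source) : Set where
    field
      word    : Source
      lefts≡  : lefts word ≡ lefts α
      rights≡ : rights word ≡ rights α
      unwoven : unweave (weave k word) ≡ word
      rest    : Target
      woven   : weave k word ≡ weave k α ++ rest
      silent  : All (λ e → program δ ⊑ℍ IpBES.label (R * T) e) rest

  postpone : ∀ k α → Iter k (lefts α) → rights α ≢ [] → Postponed k α
  postpone k [] p ne = ⊥-elim (ne refl)
  postpone k (inj₁ (_ , inj₁ _) ∷ α) (loop p) ne = record
    { word    = inj₁ (k , inj₁ tt) ∷ word
    ; lefts≡  = cong (_ ∷_) lefts≡
    ; rights≡ = rights≡
    ; unwoven = cong (_ ∷_) unwoven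
    ; rest    = rest
    ; woven   = cong (_ ∷_) woven
    ; silent  = silent
    } where open Postponed (postpone (suc k) α p ne)
  postpone k (inj₁ (j , inj₂ _) ∷ []) p ne = ⊥-elim (ne refl)
  postpone k (inj₁ (j , inj₂ _) ∷ inj₁ _ ∷ α) () ne
  -- A dropped 1 stands directly before the first event of `G`, as the loop cannot continue after
  -- it. Moved behind `α` it lands in the inner loop of copy `k`, and its image is the single event
  -- of `rest`.
  postpone k (inj₁ (j , inj₂ _) ∷ inj₂ y ∷ α) p ne = record
    { word    = inj₂ y ∷ α ∷ʳ inj₁ (j , inj₂ tt)
    ; lefts≡  = lefts-last
    ; rights≡ = cong (y ∷_) (trans (rights-++ α _) (++-identityʳ _))
    ; unwoven = unweave-guarded k y (α ∷ʳ _) (subst (Iter k) (sym lefts-last) p)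
    ; rest    = (k , inj₂ (insert y (j ℕ.∸ k , inj₂ tt))) ∷ []
    ; woven   = trans (cong (map (λ e → k , inj₂ e) ∘ (embed y ∷_)) (map-∷ʳ _ α))
                      (map-∷ʳ _ (embed y ∷ _))
    ; silent  = label-insert y (j ℕ.∸ k , inj₂ tt) ∷ []
    }
    where
    lefts-last : lefts (α ∷ʳ inj₁ (j , inj₂ tt)) ≡ (j , inj₂ tt) ∷ lefts α
    lefts-last with eq , _ ← skip⁻ p = trans (lefts-++ α _)
      (trans (cong (_++ _) eq) (cong (_ ∷_) (sym eq)))
  postpone k (inj₂ y ∷ α) p ne = record
    { word    = inj₂ y ∷ α
    ; lefts≡  = refl
    ; rights≡ = refl
    ; unwoven = unweave-guarded k y α p
    ; rest    = []
    ; woven   = sym (++-identityʳ _)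
    ; silent  = []
    }

  -- The other preimage of a word: the 1 precedes the first event of G.
  restore : ℕ → Target → Source
  restore k ((_ , inj₁ _) ∷ β) = inj₁ (k , inj₁ tt) ∷ restore (suc k) β
  restore k β                  = inj₁ (k , inj₂ tt) ∷ unweave β

  rights-restore : ∀ k β → rights (restore k β) ≡ rights (unweave β)
  rights-restore k []                 = refl
  rights-restore k ((_ , inj₁ _) ∷ β) = rights-restore (suc k) β
  rights-restore k ((_ , inj₂ _) ∷ β) = refl

  -- All that `weave` forgets is whether a 1 occurred before the first event of `G`, and the
  -- position of such a 1 is forced. So each fibre has at most two elements.
  preimage : ∀ {k} α → Iter k (lefts α) →
             α ≡ unweave (weave k α) ⊎ α ≡ restore k (weave k α)
  preimage []                       p        = inj₁ refl
  preimage (inj₁ (_ , inj₁ _) ∷ α) (loop p) =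
    Sum.map (cong (_ ∷_)) (cong (_ ∷_)) (preimage α p)
  preimage (inj₁ (_ , inj₂ _) ∷ [])           skip = inj₂ refl
  preimage (inj₁ (_ , inj₂ _) ∷ inj₁ _ ∷ α) ()
  preimage {k} (inj₁ (_ , inj₂ _) ∷ inj₂ y ∷ α) p with eq , refl ← skip⁻ p =
    inj₂ (cong (inj₁ (k , inj₂ tt) ∷_) (sym (unweave-guarded k y α (subst (Iter k) (sym eq) stop))))
  preimage {k} (inj₂ y ∷ α)         p        = inj₁ (sym (unweave-guarded k y α p))

  -- The t-simulation given by weaving

  IsSource : Source → Set₁
  IsSource α = Iter 0 (lefts α) × Path G (rights α)

  trace⇒source : ∀ {α} → IsTrace S α → IsSource α
  trace⇒source t = path⇒iter r (∥-lefts (trace⇒path t)) , ∥-rights (trace⇒path t)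

  source⇒trace : ∀ α → IsSource α → IsTrace S α
  source⇒trace α (p , q) = path⇒trace (∥-path α (iter⇒path r p) q)

  target⇒source : ∀ {β} → IsTrace (R * T) β → IsSource (unweave β)
  target⇒source t = unweave-run (path⇒Run (trace⇒path t))

  source⇒target : ∀ α → IsSource α → IsTrace (R * T) (weave 0 α)
  source⇒target α (p , q) = path⇒trace (Run⇒path 0 (weave-run α p q))

  -- Only the loop half of `IsSource` can be recomputed; the half about the arbitrary structure `G`
  -- is used under irrelevance only.
  source-iter : (α : Trace S) → Iter 0 (lefts (events α))
  source-iter (trace α t) = recompute (iter? 0 (lefts α)) (proj₁ (trace⇒source t))

  woven : Trace S → Trace (R * T)
  woven (trace α t) = trace (weave 0 α) (source⇒target α (trace⇒source t))

  -- While no event of `G` has occurred, the event supplied by `start` can be appended.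
  maximal⇒guarded : ∀ α → Maximal α → rights (events α) ≢ []
  maximal⇒guarded (trace α t) max eq
    with () ← max (trace (α ∷ʳ inj₂ (proj₁ start)) (source⇒trace _
      ( subst (Iter 0) (sym (trans (lefts-++ α _) (++-identityʳ _))) (proj₁ (trace⇒source t))
      , subst (Path G) (sym (trans (rights-++ α _) (cong (_++ _) eq))) (proj₂ start) ))) _ refl

  map≡[] : ∀ {A B : Set} (f : A → B) {α} → map f α ≡ [] → α ≡ []
  map≡[] f {[]} _ = refl

  -- The image is completed by the image of the postponed 1, if there is one. The completed word is
  -- maximal because `α` is: whether a list is a trace of `S` depends on its two sides only, so
  -- `word` and `α` have the same extensions.
  woven-weaklyMaximal : ∀ α → Maximal α → WeaklyMaximal (woven α)
  woven-weaklyMaximal (trace α t) max = inj₂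
    ( trace (weave 0 word) (source⇒target word
        ( subst (Iter 0) (sym lefts≡) (proj₁ (trace⇒source t))
        , subst (Path G) (sym rights≡) (proj₂ (trace⇒source t)) ))
    , rest , P.woven , maximal , silent )
    where
    module P = Postponed (postpone 0 α (source-iter (trace α t)) (maximal⇒guarded (trace α t) max))
    open P using (word; lefts≡; rights≡; unwoven; rest; silent)
    agree : ∀ γ → IsSource (word ++ γ) → IsSource (α ++ γ)
    agree γ (p , q) =
        subst (Iter 0) (trans (lefts-++ word γ) (trans (cong (_++ lefts γ) lefts≡)
          (sym (lefts-++ α γ)))) p
      , subst (Path G) (trans (rights-++ word γ) (trans (cong (_++ rights γ) rights≡)
          (sym (rights-++ α γ)))) q
    maximal : ∀ (β : Trace (R * T)) γ → events β ≡ weave 0 word ++ γ → γ ≡ []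
    -- An extension `γ` of the target word unweaves to an extension of `word`, hence of `α`. It is
    -- therefore empty, and so is `γ`, as `unweave` acts event by event.
    maximal (trace _ t′) γ refl = map≡[] unweaveᵉ (max
      (trace (α ++ unweave γ) (source⇒trace _ (agree (unweave γ)
        (subst IsSource (trans (map-++ unweaveᵉ (weave 0 word) γ) (cong (_++ unweave γ) unwoven))
          (target⇒source t′))))) (unweave γ) refl)

  -- Unweaving a trace always gives a trace. The restored word has the same `G` side, so only its
  -- loop side is in question, and that is decidable.
  candidates : (β : Trace (R * T)) → All (Certified S) (unweave (events β) ∷ restore 0 (events β) ∷ [])
  candidates (trace β t) =
    certify (source⇒trace (unweave β) (target⇒source t)) ∷ second (iter? 0 (lefts (restore 0 β))) ∷ []
    where
    second : Dec (Iter 0 (lefts (restore 0 β))) → Certified S (restore 0 β)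
    second (yes p) = certify (source⇒trace (restore 0 β)
      (p , subst (Path G) (sym (rights-restore 0 β)) (proj₂ (target⇒source t))))
    second (no ¬p) = refute (¬p ∘ proj₁ ∘ trace⇒source)

  woven-∷ʳ : ∀ α e αe → events αe ≡ events α ∷ʳ e →
             Grows (events α) e (events (woven α)) (events (woven αe))
  woven-∷ʳ α e αe refl = weave-∷ʳ 0 (events α) e

  insertion⇒⊑sim : r ⋆ ∥ G ⊑sim R * T
  insertion⇒⊑sim = woven , record
    { empty   = refl
    ; finite  = λ β → finite-⊆ _ (candidates β) λ { {α} refl →
                  Sum.[ here , (λ eq → there (here eq)) ]′ (preimage (events α) (source-iter α)) }
    ; step    = λ α e αe αe≡ → step α αe (woven-∷ʳ α e αe αe≡)
    ; stepMax = λ α e αe αe≡ max →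
                  stepMax α αe αe≡ max (woven-∷ʳ α e αe αe≡) , woven-weaklyMaximal αe max
    }
    where
    step : ∀ α {e} αe → Grows (events α) e (events (woven α)) (events (woven αe)) →
           (woven αe ≡ woven α × IpBES.label S e ⊑ℍ program δ) ⊎
           (∃[ e′ ] IpBES.label S e ⊑ℍ IpBES.label (R * T) e′ ×
                    events (woven αe) ≡ events (woven α) ∷ʳ e′)
    step α αe (inj₁ (e′ , eq , ⊑)) = inj₂ (e′ , ⊑ , eq)
    step α αe (inj₂ (eq , ⊑ , _))  = inj₁ (trace-≡ eq , ⊑)
    stepMax : ∀ α {e} αe → events αe ≡ events α ∷ʳ e → Maximal αe →
              Grows (events α) e (events (woven α)) (events (woven αe)) →
              ∃[ e′ ] events (woven αe) ≡ events (woven α) ∷ʳ e′ ×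
                      IpBES.label S e ⊑ℍ IpBES.label (R * T) e′
    stepMax α αe αe≡ max (inj₁ grows)      = grows
    -- If the last event were dropped, the maximal trace would contain no event of `G`.
    stepMax α αe αe≡ max (inj₂ (_ , _ , eq)) =
      ⊥-elim (maximal⇒guarded αe max (trans (cong rights αe≡) eq))

proposition4p16 : ∀ {n} (r r′ : ℍ₁ n) (b c : Test n) (ℰ ℱ : IpBES n) →
    let R  = atom (program r)
        R′ = atom (program r′)
        B  = atom (test b)
        C  = atom (test c)
    in ((r ⋆) ∥ (r ⋆) ⊑sim r ⋆)
     × ((r ⋆) ∥ R′ ⊑sim R * (R′ · (r ⋆)))
     × ((r ⋆) ∥ ((B · ℰ) + (C · ℱ)) ⊑sim R * ((B · ((r ⋆) ∥ ℰ)) + (C · ((r ⋆) ∥ ℱ))))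
     × ((r ⋆) ∥ (R′ · ℰ) ⊑sim R * (R′ · ((r ⋆) ∥ ℰ)))
proposition4p16 r r′ b c ℰ ℱ =
    ⋆∥⋆⊑⋆ r
  , insertion⇒⊑sim (atom-insertion r (program r′))
  , insertion⇒⊑sim (+-insertion (·-insertion r (test b) ℰ) (·-insertion r (test c) ℱ))
  , insertion⇒⊑sim (·-insertion r (program r′) ℰ)
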